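{- Let $N\ge 1$ and $m\ge 1$ be integers, let $\Delta\ge 1$ and $K\ge 1$ be reals, and suppose $2^m\le N/(K\Delta)$. Then there is a set $\mathcal{Y}\subseteq(\{0,1\}^m)^N$ whose entropy deficiency is at most $\Delta$ and whose min-entropy rate is at least $1-1/m$, such that for every $I\subseteq[N]$ with $|I|\le (K-1)\Delta$, the set $\mathrm{IND}_m^{[N]\setminus I}([m]^N,\mathcal{Y})$ does not contain the all-$0$ string.
   Context: The Index function $\mathrm{IND}_m:[m]\times\{0,1\}^m\to\{0,1\}$ is $\mathrm{IND}_m(x,y)=y_x$. For $\mathcal{A}\subseteq[m]^N$, $\mathcal{B}\subseteq(\{0,1\}^m)^N$ and $J\subseteq[N]$, $\mathrm{IND}_m^J(\mathcal{A},\mathcal{B})\subseteq\{0,1\}^J$ denotes the set of all vectors $(\mathrm{IND}_m(x_i,y_i))_{i\in J}$ with $x\in\mathcal{A}$, $y\in\mathcal{B}$. A set $\mathcal{S}\subseteq U^N$ is identified with the uniform distribution on it. The entropy deficiency of a distribution $\mathcal{D}$ on a finite universe $V$ is $\log_2|V|-H(\mathcal{D})$, where $H$ is Shannon entropy; for a set $\mathcal{Y}\subseteq(\{0,1\}^m)^N$ this is $mN-\log_2|\mathcal{Y}|$. The min-entropy rate of a distribution $\mathcal{D}$ on $U^N$ is the largest $\tau$ such that for every $J\subseteq[N]$ and every $\alpha_J\in U^J$, $\Pr_{x\sim\mathcal{D}}[x_J=\alpha_J]\le |U|^{ -\tau|J|}$ (here $U=\{0,1\}^m$, $|U|=2^m$).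 -}

module Defs where

open import Data.Bool using (Bool)
import Data.Bool.Properties as Bool
open import Data.Fin using (Fin)
open import Data.Fin.Subset using (Subset; inside; outside; ∣_∣)
open import Data.Integer as ℤ using (+_; +[1+_])
import Data.Integer.Properties as ℤ
open import Data.List using (List; []; _∷_; foldr; map; filter; length)
open import Data.List.Membership.Propositional using (_∈_)
open import Data.List.Relation.Unary.All using (All)
import Data.List.Relation.Unary.All as All
open import Data.List.Relation.Unary.Unique.Propositional using (Unique)
open import Data.Nat as ℕ using (ℕ; zero; suc; s≤s; z≤n)
open import Data.Nat.Logarithm using (⌊log₂_⌋; ⌊log₂⌋-mono-≤; ⌊log₂[2^n]⌋≡n; ⌊log₂⌊n/2⌋⌋≡⌊log₂n⌋∸1)
import Data.Nat.Induction as ℕ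
import Data.Nat.Properties as ℕ
open import Data.Product using (∃; _×_; _,_)
open import Data.Rational as ℚ using (ℚ; 0ℚ; 1ℚ; ½; mkℚ; ↧ₙ_; ↥_)
import Data.Rational.Properties as ℚ
open import Data.Rational.Solver using (module +-*-Solver)
open import Data.Rational.Unnormalised as ℚᵘ using (mkℚᵘ)
import Data.Rational.Unnormalised.Properties as ℚᵘ
open import Data.Sum using (inj₁; inj₂)
open import Data.Vec using (Vec; []; _∷_; lookup; zipWith)
import Data.Vec.Properties as Vec
open import Level using (0ℓ)
open import Relation.Binary using (DecidableEquality)
open import Relation.Binary.PropositionalEquality using (_≡_; refl; sym; trans; cong; cong₂; subst; subst₂)
open import Relation.Unary using (Pred; Decidable)

private
  half-pos : ∀ ε → 0ℚ ℚ.< ε → 0ℚ ℚ.< ½ ℚ.* ε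
  half-pos ε ε>0 = subst (ℚ._< ½ ℚ.* ε) (ℚ.*-zeroʳ ½) (ℚ.*-monoʳ-<-pos ½ ε>0)

  halves : ∀ ε → ½ ℚ.* ε ℚ.+ ½ ℚ.* ε ≡ ε
  halves ε = trans (sym (ℚ.*-distribʳ-+ ε ½ ½)) (ℚ.*-identityˡ ε)

  *-pos : ∀ p q → 0ℚ ℚ.< p → 0ℚ ℚ.< q → 0ℚ ℚ.< p ℚ.* q
  *-pos p q p>0 q>0 =
    subst (ℚ._< p ℚ.* q) (ℚ.*-zeroʳ p) (ℚ.*-monoʳ-<-pos p {{ℚ.positive p>0}} q>0)

  1/-pos : ∀ p (p>0 : 0ℚ ℚ.< p) → 0ℚ ℚ.< (ℚ.1/ p) {{ℚ.>-nonZero p>0}}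
  1/-pos p p>0 = ℚ.positive⁻¹ _ {{ℚ.1/pos⇒pos p {{ℚ.positive p>0}}}}

  *-mono-≤ : ∀ p q r s → 0ℚ ℚ.≤ q → 0ℚ ℚ.≤ r → p ℚ.≤ q → r ℚ.≤ s → p ℚ.* r ℚ.≤ q ℚ.* s
  *-mono-≤ p q r s q≥0 r≥0 p≤q r≤s = ℚ.≤-trans
    (ℚ.*-monoʳ-≤-nonNeg r {{ℚ.nonNegative r≥0}} p≤q)
    (ℚ.*-monoˡ-≤-nonNeg q {{ℚ.nonNegative q≥0}} r≤s)

  <⇒∣∣< : ∀ p {ε} → p ℚ.< ε → ℚ.- p ℚ.< ε → ℚ.∣ p ∣ ℚ.< ε
  <⇒∣∣< p {ε} p<ε -p<ε with ℚ.∣p∣≡p∨∣p∣≡-p p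
  ... | inj₁ eq = subst (ℚ._< ε) (sym eq) p<ε
  ... | inj₂ eq = subst (ℚ._< ε) (sym eq) -p<ε

Cauchy : (ℕ → ℚ) → Set
Cauchy s = ∀ ε → 0ℚ ℚ.< ε →
  ∃ λ M → ∀ i j → M ℕ.≤ i → M ℕ.≤ j → ℚ.∣ s i ℚ.- s j ∣ ℚ.< ε

-- Real numbers are presented by Cauchy sequences of rationals; equality of
-- reals is x ≤ y × y ≤ x, not _≡_.
record ℝ : Set where
  constructor mkℝ
  field
    seq    : ℕ → ℚ
    cauchy : Cauchy seq

open ℝ public

infix 4 _≤_ _<_

_≤_ : ℝ → ℝ → Set
x ≤ y = ∀ ε → 0ℚ ℚ.< ε → ∃ λ M → ∀ n → M ℕ.≤ n → seq x n ℚ.≤ seq y n ℚ.+ ε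

_<_ : ℝ → ℝ → Set
x < y = ∃ λ ε → 0ℚ ℚ.< ε × ∃ λ M → ∀ n → M ℕ.≤ n → seq x n ℚ.+ ε ℚ.≤ seq y n

fromℚ : ℚ → ℝ
fromℚ q = mkℝ (λ _ → q) λ ε ε>0 → 0 , λ _ _ _ _ →
  subst (ℚ._< ε) (sym (cong ℚ.∣_∣ (ℚ.+-inverseʳ q))) ε>0

fromℕ : ℕ → ℝ
fromℕ n = fromℚ (+ n ℚ./ 1)

0ℝ 1ℝ : ℝ
0ℝ = fromℚ 0ℚ
1ℝ = fromℚ 1ℚ

infixl 6 _+_ _-_
infixl 7 _*_
infix  8 -_

_+_ : ℝ → ℝ → ℝ
x + y = mkℝ (λ n → seq x n ℚ.+ seq y n) go
  where
  regroup : ∀ a b c d → (a ℚ.+ b) ℚ.- (c ℚ.+ d) ≡ (a ℚ.- c) ℚ.+ (b ℚ.- d)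
  regroup = solve 4 (λ a b c d → (a :+ b) :- (c :+ d) := (a :- c) :+ (b :- d)) refl
    where open +-*-Solver

  go : Cauchy (λ n → seq x n ℚ.+ seq y n)
  go ε ε>0 with cauchy x (½ ℚ.* ε) (half-pos ε ε>0) | cauchy y (½ ℚ.* ε) (half-pos ε ε>0)
  ... | M , p | M′ , q = M ℕ.⊔ M′ , λ i j i≥ j≥ → begin-strict
    ℚ.∣ (seq x i ℚ.+ seq y i) ℚ.- (seq x j ℚ.+ seq y j) ∣
      ≡⟨ cong ℚ.∣_∣ (regroup (seq x i) (seq y i) (seq x j) (seq y j)) ⟩
    ℚ.∣ (seq x i ℚ.- seq x j) ℚ.+ (seq y i ℚ.- seq y j) ∣
      ≤⟨ ℚ.∣p+q∣≤∣p∣+∣q∣ (seq x i ℚ.- seq x j) (seq y i ℚ.- seq y j) ⟩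
    ℚ.∣ seq x i ℚ.- seq x j ∣ ℚ.+ ℚ.∣ seq y i ℚ.- seq y j ∣
      <⟨ ℚ.+-mono-< (p i j (ℕ.m⊔n≤o⇒m≤o M M′ i≥) (ℕ.m⊔n≤o⇒m≤o M M′ j≥))
                    (q i j (ℕ.m⊔n≤o⇒n≤o M M′ i≥) (ℕ.m⊔n≤o⇒n≤o M M′ j≥)) ⟩
    ½ ℚ.* ε ℚ.+ ½ ℚ.* ε ≡⟨ halves ε ⟩
    ε ∎
    where open ℚ.≤-Reasoning

-_ : ℝ → ℝ
- x = mkℝ (λ n → ℚ.- seq x n) λ ε ε>0 →
  let M , p = cauchy x ε ε>0 in M , λ i j i≥ j≥ →
  subst (ℚ._< ε)
    (trans (sym (ℚ.∣-p∣≡∣p∣ (seq x i ℚ.- seq x j)))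
           (cong ℚ.∣_∣ (ℚ.neg-distrib-+ (seq x i) (ℚ.- seq x j))))
    (p i j i≥ j≥)

_-_ : ℝ → ℝ → ℝ
x - y = x + - y

private
  bounded : ∀ x → ∃ λ B → 0ℚ ℚ.< B × ∃ λ M → ∀ n → M ℕ.≤ n → ℚ.∣ seq x n ∣ ℚ.≤ B
  bounded x with cauchy x 1ℚ (ℚ.positive⁻¹ 1ℚ)
  ... | M , p = ℚ.∣ seq x M ∣ ℚ.+ 1ℚ
      , ℚ.<-≤-trans (ℚ.positive⁻¹ 1ℚ)
          (subst (ℚ._≤ ℚ.∣ seq x M ∣ ℚ.+ 1ℚ) (ℚ.+-identityˡ 1ℚ)
            (ℚ.+-monoˡ-≤ 1ℚ (ℚ.0≤∣p∣ (seq x M))))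
      , M , λ n n≥ → begin
    ℚ.∣ seq x n ∣                                   ≡⟨ cong ℚ.∣_∣ (split (seq x n) (seq x M)) ⟩
    ℚ.∣ seq x M ℚ.+ (seq x n ℚ.- seq x M) ∣         ≤⟨ ℚ.∣p+q∣≤∣p∣+∣q∣ (seq x M) _ ⟩
    ℚ.∣ seq x M ∣ ℚ.+ ℚ.∣ seq x n ℚ.- seq x M ∣     ≤⟨ ℚ.+-monoʳ-≤ ℚ.∣ seq x M ∣ (ℚ.<⇒≤ (p n M n≥ ℕ.≤-refl)) ⟩
    ℚ.∣ seq x M ∣ ℚ.+ 1ℚ                            ∎
    where
    open ℚ.≤-Reasoning
    split : ∀ a b → a ≡ b ℚ.+ (a ℚ.- b)
    split = solve 2 (λ a b → a := b :+ (a :- b)) refl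
      where open +-*-Solver

  cancel : ∀ {B} (B>0 : 0ℚ ℚ.< B) δ → B ℚ.* (δ ℚ.* (ℚ.1/ B) {{ℚ.>-nonZero B>0}}) ≡ δ
  cancel {B} B>0 δ = trans (swap B δ B⁻¹)
    (trans (cong (δ ℚ.*_) (ℚ.*-inverseʳ B {{ℚ.>-nonZero B>0}})) (ℚ.*-identityʳ δ))
    where
    B⁻¹ = (ℚ.1/ B) {{ℚ.>-nonZero B>0}}
    swap : ∀ a b c → a ℚ.* (b ℚ.* c) ≡ b ℚ.* (a ℚ.* c)
    swap = solve 3 (λ a b c → a :* (b :* c) := b :* (a :* c)) refl
      where open +-*-Solver

_*_ : ℝ → ℝ → ℝ
x * y = mkℝ (λ n → seq x n ℚ.* seq y n) go
  where
  regroup : ∀ a b c d → a ℚ.* b ℚ.- c ℚ.* d ≡ a ℚ.* (b ℚ.- d) ℚ.+ d ℚ.* (a ℚ.- c)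
  regroup = solve 4 (λ a b c d → a :* b :- c :* d := a :* (b :- d) :+ d :* (a :- c)) refl
    where open +-*-Solver

  small : ∀ a b δ {B} (B>0 : 0ℚ ℚ.< B) → ℚ.∣ a ∣ ℚ.≤ B →
          ℚ.∣ b ∣ ℚ.< δ ℚ.* (ℚ.1/ B) {{ℚ.>-nonZero B>0}} → ℚ.∣ a ℚ.* b ∣ ℚ.< δ
  small a b δ {B} B>0 a≤B b<η = begin-strict
    ℚ.∣ a ℚ.* b ∣                    ≡⟨ ℚ.∣p*q∣≡∣p∣*∣q∣ a b ⟩
    ℚ.∣ a ∣ ℚ.* ℚ.∣ b ∣              ≤⟨ ℚ.*-monoʳ-≤-nonNeg ℚ.∣ b ∣ {{ℚ.∣-∣-nonNeg b}} a≤B ⟩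
    B ℚ.* ℚ.∣ b ∣                    <⟨ ℚ.*-monoʳ-<-pos B {{ℚ.positive B>0}} b<η ⟩
    B ℚ.* (δ ℚ.* (ℚ.1/ B) {{ℚ.>-nonZero B>0}}) ≡⟨ cancel B>0 δ ⟩
    δ                                ∎
    where open ℚ.≤-Reasoning

  step : ∀ {B C} (B>0 : 0ℚ ℚ.< B) (C>0 : 0ℚ ℚ.< C) ε i j →
         ℚ.∣ seq x i ∣ ℚ.≤ B → ℚ.∣ seq y j ∣ ℚ.≤ C →
         ℚ.∣ seq y i ℚ.- seq y j ∣ ℚ.< ½ ℚ.* ε ℚ.* (ℚ.1/ B) {{ℚ.>-nonZero B>0}} →
         ℚ.∣ seq x i ℚ.- seq x j ∣ ℚ.< ½ ℚ.* ε ℚ.* (ℚ.1/ C) {{ℚ.>-nonZero C>0}} →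
         ℚ.∣ seq x i ℚ.* seq y i ℚ.- seq x j ℚ.* seq y j ∣ ℚ.< ε
  step B>0 C>0 ε i j x≤B y≤C y-close x-close = begin-strict
    ℚ.∣ seq x i ℚ.* seq y i ℚ.- seq x j ℚ.* seq y j ∣
      ≡⟨ cong ℚ.∣_∣ (regroup (seq x i) (seq y i) (seq x j) (seq y j)) ⟩
    ℚ.∣ seq x i ℚ.* (seq y i ℚ.- seq y j) ℚ.+ seq y j ℚ.* (seq x i ℚ.- seq x j) ∣
      ≤⟨ ℚ.∣p+q∣≤∣p∣+∣q∣ (seq x i ℚ.* (seq y i ℚ.- seq y j)) (seq y j ℚ.* (seq x i ℚ.- seq x j)) ⟩
    ℚ.∣ seq x i ℚ.* (seq y i ℚ.- seq y j) ∣ ℚ.+ ℚ.∣ seq y j ℚ.* (seq x i ℚ.- seq x j) ∣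
      <⟨ ℚ.+-mono-< (small (seq x i) (seq y i ℚ.- seq y j) (½ ℚ.* ε) B>0 x≤B y-close)
                    (small (seq y j) (seq x i ℚ.- seq x j) (½ ℚ.* ε) C>0 y≤C x-close) ⟩
    ½ ℚ.* ε ℚ.+ ½ ℚ.* ε ≡⟨ halves ε ⟩
    ε ∎
    where open ℚ.≤-Reasoning

  go : Cauchy (λ n → seq x n ℚ.* seq y n)
  go ε ε>0 =
    let B , B>0 , Mx , bx = bounded x
        C , C>0 , My , by = bounded y
        M  , p = cauchy x (½ ℚ.* ε ℚ.* (ℚ.1/ C) {{ℚ.>-nonZero C>0}})
                   (*-pos (½ ℚ.* ε) ((ℚ.1/ C) {{ℚ.>-nonZero C>0}}) (half-pos ε ε>0) (1/-pos C C>0))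
        M′ , q = cauchy y (½ ℚ.* ε ℚ.* (ℚ.1/ B) {{ℚ.>-nonZero B>0}})
                   (*-pos (½ ℚ.* ε) ((ℚ.1/ B) {{ℚ.>-nonZero B>0}}) (half-pos ε ε>0) (1/-pos B B>0))
    in (Mx ℕ.⊔ My) ℕ.⊔ (M ℕ.⊔ M′) , λ i j i≥ j≥ →
    let i≥₁ = ℕ.m⊔n≤o⇒m≤o (Mx ℕ.⊔ My) (M ℕ.⊔ M′) i≥
        i≥₂ = ℕ.m⊔n≤o⇒n≤o (Mx ℕ.⊔ My) (M ℕ.⊔ M′) i≥
        j≥₁ = ℕ.m⊔n≤o⇒m≤o (Mx ℕ.⊔ My) (M ℕ.⊔ M′) j≥
        j≥₂ = ℕ.m⊔n≤o⇒n≤o (Mx ℕ.⊔ My) (M ℕ.⊔ M′) j≥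
    in step B>0 C>0 ε i j
         (bx i (ℕ.m⊔n≤o⇒m≤o Mx My i≥₁)) (by j (ℕ.m⊔n≤o⇒n≤o Mx My j≥₁))
         (q i j (ℕ.m⊔n≤o⇒n≤o M M′ i≥₂) (ℕ.m⊔n≤o⇒n≤o M M′ j≥₂))
         (p i j (ℕ.m⊔n≤o⇒m≤o M M′ i≥₂) (ℕ.m⊔n≤o⇒m≤o M M′ j≥₂))

-- The sequence of y is shifted past the point from which it is bounded away
-- from 0, so that every term can be inverted.
reciprocal : (y : ℝ) → 0ℝ < y → ℝ
reciprocal y (δ , δ>0 , M , δ≤) = mkℝ inv go
  where
  ypos : ∀ n → 0ℚ ℚ.< seq y (M ℕ.+ n)
  ypos n = ℚ.<-≤-trans δ>0
    (subst (ℚ._≤ seq y (M ℕ.+ n)) (ℚ.+-identityˡ δ) (δ≤ (M ℕ.+ n) (ℕ.m≤m+n M n)))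

  inv : ℕ → ℚ
  inv n = (ℚ.1/ seq y (M ℕ.+ n)) {{ℚ.>-nonZero (ypos n)}}

  δ⁻¹ : ℚ
  δ⁻¹ = (ℚ.1/ δ) {{ℚ.>-nonZero δ>0}}

  inv-pos : ∀ n → 0ℚ ℚ.< inv n
  inv-pos n = 1/-pos (seq y (M ℕ.+ n)) (ypos n)

  rightInv : ∀ n → seq y (M ℕ.+ n) ℚ.* inv n ≡ 1ℚ
  rightInv n = ℚ.*-inverseʳ (seq y (M ℕ.+ n)) {{ℚ.>-nonZero (ypos n)}}

  inv≤ : ∀ n → inv n ℚ.≤ δ⁻¹
  inv≤ n = ℚ.*-cancelˡ-≤-pos δ {{ℚ.positive δ>0}} (begin
    δ ℚ.* inv n                 ≤⟨ ℚ.*-monoʳ-≤-nonNeg (inv n) {{ℚ.nonNegative (ℚ.<⇒≤ (inv-pos n))}}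
                                     (subst (ℚ._≤ seq y (M ℕ.+ n)) (ℚ.+-identityˡ δ) (δ≤ (M ℕ.+ n) (ℕ.m≤m+n M n))) ⟩
    seq y (M ℕ.+ n) ℚ.* inv n   ≡⟨ rightInv n ⟩
    1ℚ                          ≡⟨ sym (ℚ.*-inverseʳ δ {{ℚ.>-nonZero δ>0}}) ⟩
    δ ℚ.* δ⁻¹                   ∎)
    where open ℚ.≤-Reasoning

  difference : ∀ a b a′ b′ → a ℚ.* a′ ≡ 1ℚ → b ℚ.* b′ ≡ 1ℚ →
               a′ ℚ.- b′ ≡ (a′ ℚ.* b′) ℚ.* (b ℚ.- a)
  difference a b a′ b′ ea eb = sym (trans (expand a b a′ b′)
    (trans (cong₂ (λ u v → a′ ℚ.* u ℚ.- b′ ℚ.* v) eb ea)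
           (cong₂ ℚ._-_ (ℚ.*-identityʳ a′) (ℚ.*-identityʳ b′))))
    where
    expand : ∀ a b a′ b′ → (a′ ℚ.* b′) ℚ.* (b ℚ.- a) ≡ a′ ℚ.* (b ℚ.* b′) ℚ.- b′ ℚ.* (a ℚ.* a′)
    expand = solve 4 (λ a b a′ b′ →
      (a′ :* b′) :* (b :- a) := a′ :* (b :* b′) :- b′ :* (a :* a′)) refl
      where open +-*-Solver

  step : ∀ ε i j →
         ℚ.∣ seq y (M ℕ.+ j) ℚ.- seq y (M ℕ.+ i) ∣ ℚ.< (δ ℚ.* δ) ℚ.* ε →
         ℚ.∣ inv i ℚ.- inv j ∣ ℚ.< ε
  step ε i j y-close = begin-strict
    ℚ.∣ inv i ℚ.- inv j ∣
      ≡⟨ cong ℚ.∣_∣ (difference (seq y (M ℕ.+ i)) (seq y (M ℕ.+ j)) (inv i) (inv j) (rightInv i) (rightInv j)) ⟩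
    ℚ.∣ (inv i ℚ.* inv j) ℚ.* (seq y (M ℕ.+ j) ℚ.- seq y (M ℕ.+ i)) ∣
      ≡⟨ ℚ.∣p*q∣≡∣p∣*∣q∣ (inv i ℚ.* inv j) _ ⟩
    ℚ.∣ inv i ℚ.* inv j ∣ ℚ.* ℚ.∣ seq y (M ℕ.+ j) ℚ.- seq y (M ℕ.+ i) ∣
      ≡⟨ cong (ℚ._* ℚ.∣ seq y (M ℕ.+ j) ℚ.- seq y (M ℕ.+ i) ∣) (ℚ.0≤p⇒∣p∣≡p (ℚ.<⇒≤ (*-pos (inv i) (inv j) (inv-pos i) (inv-pos j)))) ⟩
    (inv i ℚ.* inv j) ℚ.* ℚ.∣ seq y (M ℕ.+ j) ℚ.- seq y (M ℕ.+ i) ∣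
      ≤⟨ ℚ.*-monoʳ-≤-nonNeg _ {{ℚ.∣-∣-nonNeg (seq y (M ℕ.+ j) ℚ.- seq y (M ℕ.+ i))}}
           (*-mono-≤ (inv i) δ⁻¹ (inv j) δ⁻¹ (ℚ.<⇒≤ (1/-pos δ δ>0)) (ℚ.<⇒≤ (inv-pos j)) (inv≤ i) (inv≤ j)) ⟩
    (δ⁻¹ ℚ.* δ⁻¹) ℚ.* ℚ.∣ seq y (M ℕ.+ j) ℚ.- seq y (M ℕ.+ i) ∣
      <⟨ ℚ.*-monoʳ-<-pos (δ⁻¹ ℚ.* δ⁻¹) {{ℚ.positive (*-pos δ⁻¹ δ⁻¹ (1/-pos δ δ>0) (1/-pos δ δ>0))}}
           y-close ⟩
    (δ⁻¹ ℚ.* δ⁻¹) ℚ.* ((δ ℚ.* δ) ℚ.* ε)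
      ≡⟨ regroup δ δ⁻¹ ε ⟩
    (δ ℚ.* δ⁻¹) ℚ.* ((δ ℚ.* δ⁻¹) ℚ.* ε)
      ≡⟨ cong (λ u → u ℚ.* (u ℚ.* ε)) (ℚ.*-inverseʳ δ {{ℚ.>-nonZero δ>0}}) ⟩
    1ℚ ℚ.* (1ℚ ℚ.* ε)
      ≡⟨ trans (ℚ.*-identityˡ _) (ℚ.*-identityˡ ε) ⟩
    ε ∎
    where
    open ℚ.≤-Reasoning
    regroup : ∀ a b e → (b ℚ.* b) ℚ.* ((a ℚ.* a) ℚ.* e) ≡ (a ℚ.* b) ℚ.* ((a ℚ.* b) ℚ.* e)
    regroup = solve 3 (λ a b e → (b :* b) :* ((a :* a) :* e) := (a :* b) :* ((a :* b) :* e)) refl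
      where open +-*-Solver

  go : Cauchy inv
  go ε ε>0 =
    let M′ , p = cauchy y ((δ ℚ.* δ) ℚ.* ε) (*-pos (δ ℚ.* δ) ε (*-pos δ δ δ>0 δ>0) ε>0)
    in M′ , λ i j i≥ j≥ → step ε i j
         (p (M ℕ.+ j) (M ℕ.+ i) (ℕ.≤-trans j≥ (ℕ.m≤n+m j M)) (ℕ.≤-trans i≥ (ℕ.m≤n+m i M)))

quotient : (x y : ℝ) → 0ℝ < y → ℝ
quotient x y y>0 = x * reciprocal y y>0

syntax quotient x y y>0 = x ÷ y [ y>0 ]

*-pos-≥1 : ∀ x y → 1ℝ ≤ x → 1ℝ ≤ y → 0ℝ < x * y
*-pos-≥1 x y 1≤x 1≤y with 1≤x ½ (ℚ.positive⁻¹ ½) | 1≤y ½ (ℚ.positive⁻¹ ½)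
... | M , p | M′ , q = ½ ℚ.* ½ , ℚ.positive⁻¹ (½ ℚ.* ½) , M ℕ.⊔ M′ , λ n n≥ →
  subst (ℚ._≤ seq x n ℚ.* seq y n) (sym (ℚ.+-identityˡ (½ ℚ.* ½)))
    (*-mono-≤ ½ (seq x n) ½ (seq y n) (ℚ.≤-trans (ℚ.nonNegative⁻¹ ½) (half≤ (seq x n) (p n (ℕ.m⊔n≤o⇒m≤o M M′ n≥))))
              (ℚ.nonNegative⁻¹ ½)
              (half≤ (seq x n) (p n (ℕ.m⊔n≤o⇒m≤o M M′ n≥)))
              (half≤ (seq y n) (q n (ℕ.m⊔n≤o⇒n≤o M M′ n≥))))
  where
  half≤ : ∀ a → 1ℚ ℚ.≤ a ℚ.+ ½ → ½ ℚ.≤ a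
  half≤ a h = subst (½ ℚ.≤_)
    (trans (ℚ.+-assoc a ½ (ℚ.- ½)) (trans (cong (a ℚ.+_) (ℚ.+-inverseʳ ½)) (ℚ.+-identityʳ a)))
    (ℚ.+-monoˡ-≤ (ℚ.- ½) h)

private
  toℚᵘ-/ : ∀ n d → ℚ.toℚᵘ (n ℚ./ suc d) ℚᵘ.≃ mkℚᵘ n d
  toℚᵘ-/ n d = ℚ.toℚᵘ-fromℚᵘ (mkℚᵘ n d)

  /-mono-≤ : ∀ a k b l → a ℕ.* suc l ℕ.≤ b ℕ.* suc k → + a ℚ./ suc k ℚ.≤ + b ℚ./ suc l
  /-mono-≤ a k b l h = ℚ.toℚᵘ-cancel-≤
    (ℚᵘ.≤-respˡ-≃ (ℚᵘ.≃-sym (toℚᵘ-/ (+ a) k))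
      (ℚᵘ.≤-respʳ-≃ (ℚᵘ.≃-sym (toℚᵘ-/ (+ b) l))
        (ℚᵘ.*≤* (subst₂ ℤ._≤_ (ℤ.pos-* a (suc l)) (ℤ.pos-* b (suc k)) (ℤ.+≤+ h)))))

  /-suc : ∀ b l → + suc b ℚ./ suc l ≡ + b ℚ./ suc l ℚ.+ + 1 ℚ./ suc l
  /-suc b l = ℚ.toℚᵘ-injective (ℚᵘ.≃-trans (toℚᵘ-/ (+ suc b) l)
    (ℚᵘ.≃-trans (ℚᵘ.*≡* (trans (cong (+ suc b ℤ.*_) (ℤ.pos-* (suc l) (suc l)))
      (trans (regroup (+ b) (+ suc l)) refl)))
    (ℚᵘ.≃-sym (ℚᵘ.≃-trans (ℚ.toℚᵘ-homo-+ (+ b ℚ./ suc l) (+ 1 ℚ./ suc l))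
      (ℚᵘ.+-cong (toℚᵘ-/ (+ b) l) (toℚᵘ-/ (+ 1) l))))))
    where
    open import Data.Integer.Solver using () renaming (module +-*-Solver to ℤ-Solver)
    open ℤ-Solver
    regroup : ∀ x y → (+ 1 ℤ.+ x) ℤ.* (y ℤ.* y) ≡ (x ℤ.* y ℤ.+ + 1 ℤ.* y) ℤ.* y
    regroup = solve 2 (λ x y → (con (+ 1) :+ x) :* (y :* y) := (x :* y :+ con (+ 1) :* y) :* y) refl

  1/-small : ∀ ε → 0ℚ ℚ.< ε → ∃ λ M → ∀ i → M ℕ.≤ i → + 1 ℚ./ suc i ℚ.< ε
  1/-small (mkℚ +[1+ n ] d c) ε>0 = suc d , λ i i≥ → ℚ.toℚᵘ-cancel-<
    (ℚᵘ.<-respˡ-≃ (ℚᵘ.≃-sym (toℚᵘ-/ (+ 1) i))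
      (ℚᵘ.*<* (subst₂ ℤ._<_ (ℤ.pos-* 1 (suc d)) (ℤ.pos-* (suc n) (suc i))
        (ℤ.+<+ (ℕ.<-≤-trans
          (subst (ℕ._< suc i) (sym (ℕ.*-identityˡ (suc d))) (s≤s i≥))
          (ℕ.m≤m+n (suc i) (n ℕ.* suc i)))))))
  1/-small (mkℚ (+ 0) d c) (ℚ.*<* (ℤ.+<+ ()))
  1/-small (mkℚ (ℤ.-[1+ n ]) d c) (ℚ.*<* ())

  2^⌊log₂⌋≤ : ∀ n → .{{_ : ℕ.NonZero n}} → 2 ℕ.^ ⌊log₂ n ⌋ ℕ.≤ n
  2^⌊log₂⌋≤ = ℕ.<-rec (λ n → .{{_ : ℕ.NonZero n}} → 2 ℕ.^ ⌊log₂ n ⌋ ℕ.≤ n) step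
    where
    step : ∀ n → (∀ {k} → k ℕ.< n → .{{_ : ℕ.NonZero k}} → 2 ℕ.^ ⌊log₂ k ⌋ ℕ.≤ k) →
           .{{_ : ℕ.NonZero n}} → 2 ℕ.^ ⌊log₂ n ⌋ ℕ.≤ n
    step 1 rec = s≤s z≤n
    step n@(suc (suc k)) rec = begin
      2 ℕ.^ ⌊log₂ n ⌋                    ≤⟨ ℕ.^-monoʳ-≤ 2 (ℕ.m≤n+m∸n ⌊log₂ n ⌋ 1) ⟩
      2 ℕ.* 2 ℕ.^ (⌊log₂ n ⌋ ℕ.∸ 1)      ≡⟨ cong (λ e → 2 ℕ.* 2 ℕ.^ e) (sym (⌊log₂⌊n/2⌋⌋≡⌊log₂n⌋∸1 n)) ⟩
      2 ℕ.* 2 ℕ.^ ⌊log₂ ℕ.⌊ n /2⌋ ⌋      ≤⟨ ℕ.*-monoʳ-≤ 2 (rec (ℕ.⌊n/2⌋<n (suc k))) ⟩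
      2 ℕ.* ℕ.⌊ n /2⌋                    ≡⟨ cong (ℕ.⌊ n /2⌋ ℕ.+_) (ℕ.+-identityʳ ℕ.⌊ n /2⌋) ⟩
      ℕ.⌊ n /2⌋ ℕ.+ ℕ.⌊ n /2⌋            ≤⟨ ℕ.+-monoʳ-≤ ℕ.⌊ n /2⌋ (ℕ.⌊n/2⌋≤⌈n/2⌉ n) ⟩
      ℕ.⌊ n /2⌋ ℕ.+ ℕ.⌈ n /2⌉            ≡⟨ ℕ.⌊n/2⌋+⌈n/2⌉≡n n ⟩
      n                                  ∎
      where open ℕ.≤-Reasoning

  <2^1+⌊log₂⌋ : ∀ n → n ℕ.< 2 ℕ.^ suc ⌊log₂ n ⌋
  <2^1+⌊log₂⌋ n = ℕ.≰⇒> λ h → ℕ.<-irrefl refl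
    (subst (ℕ._≤ ⌊log₂ n ⌋) (⌊log₂[2^n]⌋≡n (suc ⌊log₂ n ⌋)) (⌊log₂⌋-mono-≤ h))

  2^-cancel-< : ∀ a b → 2 ℕ.^ a ℕ.< 2 ℕ.^ b → a ℕ.< b
  2^-cancel-< a b h = ℕ.≰⇒> λ b≤a → ℕ.<⇒≱ h (ℕ.^-monoʳ-≤ 2 b≤a)

  logs : ∀ n → .{{_ : ℕ.NonZero n}} → ∀ k l →
         ⌊log₂ n ℕ.^ suc k ⌋ ℕ.* suc l ℕ.< suc ⌊log₂ n ℕ.^ suc l ⌋ ℕ.* suc k
  logs n k l = 2^-cancel-< _ _ (begin-strict
    2 ℕ.^ (⌊log₂ n ℕ.^ suc k ⌋ ℕ.* suc l)      ≡⟨ sym (ℕ.^-*-assoc 2 ⌊log₂ n ℕ.^ suc k ⌋ (suc l)) ⟩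
    (2 ℕ.^ ⌊log₂ n ℕ.^ suc k ⌋) ℕ.^ suc l      ≤⟨ ℕ.^-monoˡ-≤ (suc l) (2^⌊log₂⌋≤ (n ℕ.^ suc k) {{ℕ.m^n≢0 n (suc k)}}) ⟩
    (n ℕ.^ suc k) ℕ.^ suc l                    ≡⟨ ℕ.^-*-assoc n (suc k) (suc l) ⟩
    n ℕ.^ (suc k ℕ.* suc l)                    ≡⟨ cong (n ℕ.^_) (ℕ.*-comm (suc k) (suc l)) ⟩
    n ℕ.^ (suc l ℕ.* suc k)                    ≡⟨ sym (ℕ.^-*-assoc n (suc l) (suc k)) ⟩
    (n ℕ.^ suc l) ℕ.^ suc k                    <⟨ ℕ.^-monoˡ-< (suc k) (<2^1+⌊log₂⌋ (n ℕ.^ suc l)) ⟩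
    (2 ℕ.^ suc ⌊log₂ n ℕ.^ suc l ⌋) ℕ.^ suc k  ≡⟨ ℕ.^-*-assoc 2 (suc ⌊log₂ n ℕ.^ suc l ⌋) (suc k) ⟩
    2 ℕ.^ (suc ⌊log₂ n ℕ.^ suc l ⌋ ℕ.* suc k)  ∎)
    where open ℕ.≤-Reasoning

-- log₂ n is the limit of ⌊log₂ nᵏ⌋ / k, which is within 1/k of it.  The value
-- at 0 is the dummy value 0.
log₂ℕ : ℕ → ℝ
log₂ℕ zero        = 0ℝ
log₂ℕ n@(suc n-1) = mkℝ approx go
  where
  approx : ℕ → ℚ
  approx k = + ⌊log₂ n ℕ.^ suc k ⌋ ℚ./ suc k

  close : ∀ k l → approx k ℚ.- approx l ℚ.≤ + 1 ℚ./ suc l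
  close k l = begin
    approx k ℚ.- approx l
      ≤⟨ ℚ.+-monoˡ-≤ (ℚ.- approx l) (/-mono-≤ ⌊log₂ n ℕ.^ suc k ⌋ k (suc ⌊log₂ n ℕ.^ suc l ⌋) l (ℕ.<⇒≤ (logs n k l))) ⟩
    + suc ⌊log₂ n ℕ.^ suc l ⌋ ℚ./ suc l ℚ.- approx l
      ≡⟨ cong (ℚ._- approx l) (/-suc ⌊log₂ n ℕ.^ suc l ⌋ l) ⟩
    (approx l ℚ.+ + 1 ℚ./ suc l) ℚ.- approx l
      ≡⟨ cancelˡ (approx l) (+ 1 ℚ./ suc l) ⟩
    + 1 ℚ./ suc l ∎
    where
    open ℚ.≤-Reasoning
    cancelˡ : ∀ a b → (a ℚ.+ b) ℚ.- a ≡ b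
    cancelˡ = solve 2 (λ a b → (a :+ b) :- a := b) refl
      where open +-*-Solver

  flip : ∀ a b → ℚ.- (a ℚ.- b) ≡ b ℚ.- a
  flip = solve 2 (λ a b → :- (a :- b) := b :- a) refl
    where open +-*-Solver

  go : Cauchy approx
  go ε ε>0 with 1/-small ε ε>0
  ... | M , small = M , λ i j i≥ j≥ → <⇒∣∣< (approx i ℚ.- approx j)
    (ℚ.≤-<-trans (close i j) (small j j≥))
    (subst (ℚ._< ε) (sym (flip (approx i) (approx j))) (ℚ.≤-<-trans (close j i) (small i i≥)))

-- Meaningful for p > 0 only.
log₂ : ℚ → ℝ
log₂ p = log₂ℕ ℤ.∣ ↥ p ∣ - log₂ℕ (↧ₙ p)

infix 4 _≤_^_

-- p ≤ uˣ for p ≥ 0, u ≥ 1 and a real exponent x, where uˣ = 2^(x log₂ u) and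
-- 2^ is the inverse of log₂; the inequality is automatic when p = 0.
_≤_^_ : ℚ → ℕ → ℝ → Set
p ≤ u ^ x = 0ℚ ℚ.< p → log₂ p ≤ x * log₂ℕ u

record FinSet (V : Set) : Set where
  field
    elements : List V
    unique   : Unique elements

open FinSet public

card : ∀ {V} → FinSet V → ℕ
card S = length (elements S)

⟦_⟧ : ∀ {V} → FinSet V → Pred V 0ℓ
⟦ S ⟧ v = v ∈ elements S

sumℚ : List ℚ → ℚ
sumℚ = foldr ℚ._+_ 0ℚ

sumℝ : List ℝ → ℝ
sumℝ = foldr _+_ 0ℝ

-- Points outside the support have probability 0, whatever prob says there.
record Distribution (V : Set) : Set where
  field
    support : FinSet V
    prob    : V → ℚ
    nonneg  : All (λ v → 0ℚ ℚ.≤ prob v) (elements support)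
    total   : sumℚ (map prob (elements support)) ≡ 1ℚ

open Distribution public

Pr : ∀ {V} {P : Pred V 0ℓ} → Distribution V → Decidable P → ℚ
Pr D P? = sumℚ (map (prob D) (filter P? (elements (support D))))

uniform : ∀ {V} (S : FinSet V) → .{{_ : ℕ.NonZero (card S)}} → Distribution V
uniform S = record
  { support = S
  ; prob    = λ _ → + 1 ℚ./ card S
  ; nonneg  = All.universal (λ _ → 1/n≥0 (card S)) (elements S)
  ; total   = trans (const-sum (+ 1 ℚ./ card S) (elements S)) (n*1/n≡1 (card S))
  }
  where
  1/n≥0 : ∀ n → .{{_ : ℕ.NonZero n}} → 0ℚ ℚ.≤ + 1 ℚ./ n
  1/n≥0 n = ℚ.nonNegative⁻¹ (+ 1 ℚ./ n) {{ℚ.normalize-nonNeg 1 n}}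

  const-sum : ∀ {V : Set} q (xs : List V) → sumℚ (map (λ _ → q) xs) ≡ (+ length xs ℚ./ 1) ℚ.* q
  const-sum q []       = sym (ℚ.*-zeroˡ q)
  const-sum q (x ∷ xs) = trans (cong (q ℚ.+_) (const-sum q xs))
    (trans (factor q (+ length xs ℚ./ 1)) (cong (ℚ._* q) (sym (/-suc (length xs) 0))))
    where
    factor : ∀ a b → a ℚ.+ b ℚ.* a ≡ (b ℚ.+ 1ℚ) ℚ.* a
    factor = solve 2 (λ a b → a :+ b :* a := (b :+ con 1ℚ) :* a) refl
      where open +-*-Solver

  n*1/n≡1 : ∀ n → .{{_ : ℕ.NonZero n}} → (+ n ℚ./ 1) ℚ.* (+ 1 ℚ./ n) ≡ 1ℚ
  n*1/n≡1 (suc k) = ℚ.toℚᵘ-injective (ℚᵘ.≃-trans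
    (ℚ.toℚᵘ-homo-* (+ suc k ℚ./ 1) (+ 1 ℚ./ suc k))
    (ℚᵘ.≃-trans (ℚᵘ.*-cong (toℚᵘ-/ (+ suc k) 0) (toℚᵘ-/ (+ 1) k))
      (ℚᵘ.*≡* (trans (ℤ.*-identityʳ _) (trans (ℤ.*-identityʳ (+ suc k))
        (sym (trans (ℤ.*-identityˡ _) (cong +_ (ℕ.*-identityˡ (suc k))))))))))

entropy : ∀ {V} → Distribution V → ℝ
entropy D = sumℝ (map (λ v → - (fromℚ (prob D v) * log₂ (prob D v))) (elements (support D)))

-- The universe ({0,1}ᵐ)ᴺ has (2ᵐ)ᴺ elements.
entropyDeficiency : ∀ {m N} → Distribution (Vec (Vec Bool m) N) → ℝ
entropyDeficiency {m} {N} D = log₂ℕ ((2 ℕ.^ m) ℕ.^ N) - entropy D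

-- x ↦ x_J, with Uᴶ taken as vectors of length ∣ J ∣ indexed by J in
-- increasing order.
restrict : ∀ {A : Set} {N} (J : Subset N) → Vec A N → Vec A ∣ J ∣
restrict []            []       = []
restrict (inside  ∷ J) (x ∷ xs) = x ∷ restrict J xs
restrict (outside ∷ J) (x ∷ xs) = restrict J xs

_≟ᵛ_ : ∀ {m k} → DecidableEquality (Vec (Vec Bool m) k)
_≟ᵛ_ = Vec.≡-dec (Vec.≡-dec Bool._≟_)

AdmissibleRate : ∀ {m N} → Distribution (Vec (Vec Bool m) N) → ℝ → Set
AdmissibleRate {m} {N} D τ = (J : Subset N) (α : Vec (Vec Bool m) ∣ J ∣) →
  Pr D (λ y → restrict J y ≟ᵛ α) ≤ (2 ℕ.^ m) ^ (- (τ * fromℕ ∣ J ∣))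

-- The min-entropy rate is the largest admissible τ, so it is at least r exactly
-- when some admissible τ is.
MinEntropyRate≥ : ∀ {m N} → Distribution (Vec (Vec Bool m) N) → ℝ → Set
MinEntropyRate≥ D r = ∃ λ τ → AdmissibleRate D τ × r ≤ τ

IND : ∀ {m} → Fin m → Vec Bool m → Bool
IND x y = lookup y x

INDᴶ : ∀ {m N} (J : Subset N) → Pred (Vec (Fin m) N) 0ℓ → Pred (Vec (Vec Bool m) N) 0ℓ →
       Pred (Vec Bool ∣ J ∣) 0ℓ
INDᴶ J A B z = ∃ λ x → ∃ λ y → A x × B y × z ≡ restrict J (zipWith IND x y)

{-# OPTIONS --safe #-}
module Submission where

-- Let M = 2^m and k = ⌊N / M⌋, and let Y consist of the y for which at least k
-- of the N blocks are the all-ones word.  If x and y give the all-0 string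
-- outside I, then no block of y outside I is all ones, so k ≤ |I|; but
-- |I| ≤ (K − 1)Δ ≤ N / M − 1 forces |I| < k.
--
-- Y contains at least half of the universe.  With a = M − 1, exactly
-- f(j) = C(N, j) a^(N−j) vectors have j all-ones blocks; as N ≥ k M, comparing
-- consecutive ratios gives f(k−1−i) ≤ f(k+i) for all i < k, so the vectors with
-- fewer than k such blocks are matched by those with k, …, 2k−1 of them.
--
-- Hence the deficiency of Y is at most 1 ≤ Δ, and fixing the blocks in J ≠ ∅
-- has probability at most 2 · 2^(−m|J|) ≤ 2^(−(m−1)|J|).

open import Defs
open import Data.Bool using (Bool; true; false)
import Data.Bool.Properties as Bool
open import Data.Fin using (Fin)
open import Data.Fin.Subset using (Subset; inside; outside; ∁; ∣_∣)
open import Data.Integer as ℤ using (+_; +[1+_])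
import Data.Integer.Properties as ℤ
open import Data.Integer.Solver using () renaming (module +-*-Solver to ℤ-Solver)
open import Data.List using (List; []; _∷_; _++_; map; filter; length; cartesianProductWith)
open import Data.List.Membership.Propositional.Properties using (∈-filter⁻)
import Data.List.Properties as List
open import Data.List.Relation.Unary.All using (All; []; _∷_)
import Data.List.Relation.Unary.All as All
import Data.List.Relation.Unary.All.Properties as All
open import Data.List.Relation.Unary.Unique.Propositional using (Unique; []; _∷_)
import Data.List.Relation.Unary.Unique.Propositional.Properties as Unique
open import Data.Nat as ℕ using (ℕ; zero; suc; s≤s; z≤n)
import Data.Nat.Coprimality as ℕ
import Data.Nat.DivMod as ℕ
open import Data.Nat.Logarithm using (⌊log₂_⌋; ⌊log₂⌋-mono-≤; ⌊log₂[2*b]⌋≡1+⌊log₂b⌋)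
import Data.Nat.Properties as ℕ
open import Data.Nat.Solver using () renaming (module +-*-Solver to ℕ-Solver)
open import Data.Product using (Σ; ∃; _×_; _,_; proj₁; proj₂)
open import Data.Rational as ℚ using (ℚ; 0ℚ; 1ℚ; mkℚ)
import Data.Rational.Properties as ℚ
open import Data.Rational.Solver using () renaming (module +-*-Solver to ℚ-Solver)
open import Data.Rational.Unnormalised as ℚᵘ using (mkℚᵘ)
import Data.Rational.Unnormalised.Properties as ℚᵘ
open import Data.Vec using (Vec; []; _∷_; zipWith; count; replicate)
import Data.Vec.Properties as Vec
open import Function using (_∘_; id)
open import Level using (0ℓ)
open import Relation.Binary using (DecidableEquality)
open import Relation.Binary.PropositionalEquality using (_≡_; _≢_; refl; sym; trans; cong; cong₂; subst; subst₂; setoid)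
open import Relation.Nullary using (Dec; ¬_; yes; no; does; contradiction)
open import Relation.Unary using (Pred; Decidable; U; _∉_; _⊆_)

-- Binomial counts

module Binomial (a : ℕ) where

  -- exactly n j = C(n, j) a^(n−j), and below n k is its sum over j < k.
  exactly : ℕ → ℕ → ℕ
  exactly zero    zero    = 1
  exactly zero    (suc j) = 0
  exactly (suc n) zero    = a ℕ.* exactly n zero
  exactly (suc n) (suc j) = exactly n j ℕ.+ a ℕ.* exactly n (suc j)

  below : ℕ → ℕ → ℕ
  below n       zero    = 0
  below zero    (suc k) = 1
  below (suc n) (suc k) = below n k ℕ.+ a ℕ.* below n (suc k)

  -- The full sum over j is (1 + a)^n by the binomial theorem. The partial sums obey the same
  -- recursion in n, so the induction bounds them without forming the full sum.
  below≤^ : ∀ n k → below n k ℕ.≤ suc a ℕ.^ n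
  below≤^ n       zero    = z≤n
  below≤^ zero    (suc k) = ℕ.≤-refl
  below≤^ (suc n) (suc k) = ℕ.+-mono-≤ (below≤^ n k) (ℕ.*-monoʳ-≤ a (below≤^ n (suc k)))

  below-suc : ∀ n k → below n (suc k) ≡ below n k ℕ.+ exactly n k
  below-suc zero    zero    = refl
  below-suc zero    (suc k) = refl
  below-suc (suc n) zero    = cong (a ℕ.*_) (below-suc n zero)
  below-suc (suc n) (suc k) = trans
    (cong₂ (λ u v → u ℕ.+ a ℕ.* v) (below-suc n k) (below-suc n (suc k)))
    (regroup (below n k) (exactly n k) a (below n (suc k)) (exactly n (suc k)))
    where
    open ℕ-Solver
    regroup : ∀ s f a t g → (s ℕ.+ f) ℕ.+ a ℕ.* (t ℕ.+ g) ≡ (s ℕ.+ a ℕ.* t) ℕ.+ (f ℕ.+ a ℕ.* g)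
    regroup = solve 5 (λ s f a t g → (s :+ f) :+ a :* (t :+ g) := (s :+ a :* t) :+ (f :+ a :* g)) refl

  -- This is (j + 1) C(n, j + 1) = (n - j) C(n, j), multiplied by a^(n-j). The term with factor j
  -- stands on the left so that no truncated subtraction occurs; past j = n both sides vanish.
  exactly-step : ∀ n j →
    exactly n (suc j) ℕ.* (suc j ℕ.* a) ℕ.+ exactly n j ℕ.* j ≡ exactly n j ℕ.* n
  exactly-step zero zero    = refl
  exactly-step zero (suc j) = refl
  exactly-step (suc n) zero = trans
    (regroup (exactly n 0) (exactly n 1) a)
    (trans (cong (λ u → exactly n 0 ℕ.* a ℕ.+ a ℕ.* u) (exactly-step n zero))
      (regroup′ (exactly n 0) a n))
    where
    open ℕ-Solver
    regroup : ∀ f g a → (f ℕ.+ a ℕ.* g) ℕ.* (1 ℕ.* a) ℕ.+ a ℕ.* f ℕ.* 0 ≡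
                        f ℕ.* a ℕ.+ a ℕ.* (g ℕ.* (1 ℕ.* a) ℕ.+ f ℕ.* 0)
    regroup = solve 3 (λ f g a → (f :+ a :* g) :* (con 1 :* a) :+ a :* f :* con 0 :=
                        f :* a :+ a :* (g :* (con 1 :* a) :+ f :* con 0)) refl
    regroup′ : ∀ f a n → f ℕ.* a ℕ.+ a ℕ.* (f ℕ.* n) ≡ a ℕ.* f ℕ.* suc n
    regroup′ = solve 3 (λ f a n → f :* a :+ a :* (f :* n) := a :* f :* (con 1 :+ n)) refl
  exactly-step (suc n) (suc j) = trans
    (regroup (exactly n j) (exactly n (suc j)) (exactly n (suc (suc j))) a j)
    (trans (cong₂ (λ u v → u ℕ.+ F ℕ.+ G ℕ.* a ℕ.+ a ℕ.* v) (exactly-step n j) (exactly-step n (suc j)))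
      (regroup′ F G a n))
    where
    F = exactly n j
    G = exactly n (suc j)
    open ℕ-Solver
    regroup : ∀ f g h a j →
      (g ℕ.+ a ℕ.* h) ℕ.* ((2 ℕ.+ j) ℕ.* a) ℕ.+ (f ℕ.+ a ℕ.* g) ℕ.* suc j ≡
      (g ℕ.* (suc j ℕ.* a) ℕ.+ f ℕ.* j) ℕ.+ f ℕ.+ g ℕ.* a ℕ.+ a ℕ.* (h ℕ.* ((2 ℕ.+ j) ℕ.* a) ℕ.+ g ℕ.* suc j)
    regroup = solve 5 (λ f g h a j →
      (g :+ a :* h) :* ((con 2 :+ j) :* a) :+ (f :+ a :* g) :* (con 1 :+ j) :=
      (g :* ((con 1 :+ j) :* a) :+ f :* j) :+ f :+ g :* a
        :+ a :* (h :* ((con 2 :+ j) :* a) :+ g :* (con 1 :+ j))) refl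
    regroup′ : ∀ f g a n → f ℕ.* n ℕ.+ f ℕ.+ g ℕ.* a ℕ.+ a ℕ.* (g ℕ.* n) ≡ (f ℕ.+ a ℕ.* g) ℕ.* suc n
    regroup′ = solve 4 (λ f g a n →
      f :* n :+ f :+ g :* a :+ a :* (g :* n) := (f :+ a :* g) :* (con 1 :+ n)) refl

  exactly-ratio : ∀ {n} j r → j ℕ.+ r ≡ n → exactly n (suc j) ℕ.* (suc j ℕ.* a) ≡ exactly n j ℕ.* r
  exactly-ratio {n} j r refl = ℕ.+-cancelʳ-≡ (exactly n j ℕ.* j) _ _
    (trans (exactly-step n j)
      (trans (ℕ.*-distribˡ-+ (exactly n j) j r) (ℕ.+-comm (exactly n j ℕ.* j) (exactly n j ℕ.* r))))

-- Comparison of binomial terms around the median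

private
  -- With k = p + q, n − k ≥ k a and r = n − k + 1 − p, where a = 1 + a′, this is
  -- (k² − p²) a² ≤ (n − k + 1)² − p².
  square-gap : ∀ p q r a′ → q ℕ.* suc a′ ℕ.+ p ℕ.* a′ ℕ.≤ r →
               q ℕ.* suc a′ ℕ.* ((q ℕ.+ 2 ℕ.* p) ℕ.* suc a′) ℕ.≤ r ℕ.* (r ℕ.+ 2 ℕ.* p)
  square-gap p q r a′ h = begin
    q ℕ.* suc a′ ℕ.* ((q ℕ.+ 2 ℕ.* p) ℕ.* suc a′)
      ≤⟨ ℕ.m≤m+n _ (p ℕ.* a′ ℕ.* (p ℕ.* a′ ℕ.+ 2 ℕ.* p)) ⟩
    q ℕ.* suc a′ ℕ.* ((q ℕ.+ 2 ℕ.* p) ℕ.* suc a′) ℕ.+ p ℕ.* a′ ℕ.* (p ℕ.* a′ ℕ.+ 2 ℕ.* p)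
      ≡⟨ expand p q a′ ⟩
    s ℕ.* (s ℕ.+ 2 ℕ.* p)
      ≤⟨ ℕ.*-mono-≤ h (ℕ.+-monoˡ-≤ (2 ℕ.* p) h) ⟩
    r ℕ.* (r ℕ.+ 2 ℕ.* p) ∎
    where
    open ℕ.≤-Reasoning
    s = q ℕ.* suc a′ ℕ.+ p ℕ.* a′
    expand : ∀ p q a′ →
      q ℕ.* suc a′ ℕ.* ((q ℕ.+ 2 ℕ.* p) ℕ.* suc a′) ℕ.+ p ℕ.* a′ ℕ.* (p ℕ.* a′ ℕ.+ 2 ℕ.* p) ≡
      (q ℕ.* suc a′ ℕ.+ p ℕ.* a′) ℕ.* (q ℕ.* suc a′ ℕ.+ p ℕ.* a′ ℕ.+ 2 ℕ.* p)
    expand = solve 3 (λ p q a →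
      q :* (con 1 :+ a) :* ((q :+ con 2 :* p) :* (con 1 :+ a)) :+ p :* a :* (p :* a :+ con 2 :* p) :=
      (q :* (con 1 :+ a) :+ p :* a) :* (q :* (con 1 :+ a) :+ p :* a :+ con 2 :* p)) refl
      where open ℕ-Solver

module Median (a′ : ℕ) where

  open Binomial (suc a′)

  private
    a : ℕ
    a = suc a′

  -- The indices l = k - 1 - i and k + i are mirror images. For i = 0 the claim is one consecutive
  -- ratio, (b + 1) / (k a) ≥ 1. Each further step moves both indices outwards by one and multiplies
  -- by a ratio at either end; `square-gap` bounds the product of the two.
  reflect : ∀ {n k} b → k ℕ.+ b ≡ n → k ℕ.* a ℕ.≤ b →
            ∀ i l → suc (i ℕ.+ l) ≡ k → exactly n l ℕ.≤ exactly n (k ℕ.+ i)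
  reflect {n} b refl ka≤b zero l refl =
    ℕ.*-cancelʳ-≤ _ _ (suc b) (begin
      exactly n l ℕ.* suc b              ≡⟨ exactly-ratio l (suc b) (ℕ.+-suc l b) ⟨
      exactly n (suc l) ℕ.* (suc l ℕ.* a) ≤⟨ ℕ.*-monoʳ-≤ (exactly n (suc l)) (ℕ.m≤n⇒m≤1+n ka≤b) ⟩
      exactly n (suc l) ℕ.* suc b        ≡⟨ cong (λ j → exactly n j ℕ.* suc b) (sym (ℕ.+-identityʳ (suc l))) ⟩
      exactly n (suc l ℕ.+ 0) ℕ.* suc b  ∎)
    where open ℕ.≤-Reasoning
  reflect {n} b refl ka≤b (suc i) l refl =
    ℕ.*-cancelʳ-≤ _ _ (t ℕ.* r) {{ℕ.m*n≢0 t r {{_}} {{r≢0}}}} (begin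
      exactly n l ℕ.* (t ℕ.* r)
        ≡⟨ ℕ.*-assoc (exactly n l) t r ⟨
      exactly n l ℕ.* t ℕ.* r
        ≡⟨ cong (ℕ._* r) (exactly-ratio l t l+t≡n) ⟨
      exactly n (suc l) ℕ.* (suc l ℕ.* a) ℕ.* r
        ≤⟨ ℕ.*-monoˡ-≤ r (ℕ.*-monoˡ-≤ (suc l ℕ.* a) (reflect b refl ka≤b i (suc l) (cong suc (ℕ.+-suc i l)))) ⟩
      exactly n (k ℕ.+ i) ℕ.* (suc l ℕ.* a) ℕ.* r
        ≡⟨ swap (exactly n (k ℕ.+ i)) (suc l ℕ.* a) r ⟩
      exactly n (k ℕ.+ i) ℕ.* r ℕ.* (suc l ℕ.* a)
        ≡⟨ cong (ℕ._* (suc l ℕ.* a)) (exactly-ratio (k ℕ.+ i) r k+i+r≡n) ⟨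
      exactly n (suc (k ℕ.+ i)) ℕ.* (suc (k ℕ.+ i) ℕ.* a) ℕ.* (suc l ℕ.* a)
        ≡⟨ rearrange (exactly n (suc (k ℕ.+ i))) i l a ⟩
      exactly n (suc (k ℕ.+ i)) ℕ.* (q ℕ.* a ℕ.* ((q ℕ.+ 2 ℕ.* p) ℕ.* a))
        -- Here k + i + 1 = q + 2p, and t = r + 2p where t = n - l and r = n - k - i, so both ratios
        -- are expressed through their distance from the centre.
        ≤⟨ ℕ.*-monoʳ-≤ (exactly n (suc (k ℕ.+ i))) (square-gap p q r a′ gap) ⟩
      exactly n (suc (k ℕ.+ i)) ℕ.* (r ℕ.* (r ℕ.+ 2 ℕ.* p))
        ≡⟨ cong (exactly n (suc (k ℕ.+ i)) ℕ.*_) r*[r+2p]≡t*r ⟩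
      exactly n (suc (k ℕ.+ i)) ℕ.* (t ℕ.* r)
        ≡⟨ cong (λ j → exactly n j ℕ.* (t ℕ.* r)) (sym (ℕ.+-suc k i)) ⟩
      exactly n (k ℕ.+ suc i) ℕ.* (t ℕ.* r) ∎)
    where
    open ℕ.≤-Reasoning
    k p q t r : ℕ
    k = suc (suc i ℕ.+ l)
    p = suc i
    q = suc l
    t = 2 ℕ.+ i ℕ.+ b
    r = b ℕ.∸ i

    -- Since p = i + 1 and a = a′ + 1, the left side plus one equals p a + q a = k a.
    lower : i ℕ.+ (q ℕ.* a ℕ.+ p ℕ.* a′) ℕ.< k ℕ.* a
    lower = ℕ.≤-reflexive (solve 3 (λ i l a →
      con 1 :+ (i :+ ((con 1 :+ l) :* (con 1 :+ a) :+ (con 1 :+ i) :* a)) :=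
      (con 2 :+ i :+ l) :* (con 1 :+ a)) refl i l a′)
      where open ℕ-Solver

    i≤b : i ℕ.≤ b
    i≤b = ℕ.≤-trans (ℕ.m≤m+n i _) (ℕ.≤-trans (ℕ.<⇒≤ lower) ka≤b)

    i+r≡b : i ℕ.+ r ≡ b
    i+r≡b = ℕ.m+[n∸m]≡n i≤b

    gap : q ℕ.* a ℕ.+ p ℕ.* a′ ℕ.≤ r
    gap = ℕ.+-cancelˡ-≤ i _ _ (ℕ.≤-trans (ℕ.<⇒≤ lower) (ℕ.≤-trans ka≤b (ℕ.≤-reflexive (sym i+r≡b))))

    r≢0 : ℕ.NonZero r
    r≢0 = ℕ.>-nonZero (ℕ.≤-trans (s≤s z≤n) gap)

    l+t≡n : l ℕ.+ t ≡ k ℕ.+ b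
    l+t≡n = solve 3 (λ i l b → l :+ (con 2 :+ i :+ b) := con 2 :+ i :+ l :+ b) refl i l b
      where open ℕ-Solver

    k+i+r≡n : k ℕ.+ i ℕ.+ r ≡ k ℕ.+ b
    k+i+r≡n = trans (ℕ.+-assoc k i r) (cong (k ℕ.+_) i+r≡b)

    r*[r+2p]≡t*r : r ℕ.* (r ℕ.+ 2 ℕ.* p) ≡ t ℕ.* r
    r*[r+2p]≡t*r = trans (solve 2 (λ i r →
      r :* (r :+ con 2 :* (con 1 :+ i)) := (con 2 :+ i :+ (i :+ r)) :* r) refl i r)
      (cong (λ u → (2 ℕ.+ i ℕ.+ u) ℕ.* r) i+r≡b)
      where open ℕ-Solver

    swap : ∀ x y z → x ℕ.* y ℕ.* z ≡ x ℕ.* z ℕ.* y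
    swap = solve 3 (λ x y z → x :* y :* z := x :* z :* y) refl
      where open ℕ-Solver

    rearrange : ∀ e i l a → e ℕ.* (suc (suc (suc i ℕ.+ l) ℕ.+ i) ℕ.* a) ℕ.* (suc l ℕ.* a) ≡
                e ℕ.* (suc l ℕ.* a ℕ.* ((suc l ℕ.+ 2 ℕ.* suc i) ℕ.* a))
    rearrange = solve 4 (λ e i l a →
      e :* ((con 1 :+ (con 2 :+ i :+ l :+ i)) :* a) :* ((con 1 :+ l) :* a) :=
      e :* ((con 1 :+ l) :* a :* ((con 1 :+ l :+ con 2 :* (con 1 :+ i)) :* a))) refl
      where open ℕ-Solver

  -- Induction on i, starting from equality: each step drops the term at l from the second sum and
  -- adds the term at k + i to the first, which is no smaller by `reflect`. At l = 0 the second sum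
  -- is empty.
  below-symmetric : ∀ {n k} → k ℕ.* suc a ℕ.≤ n → ∀ i l → i ℕ.+ l ≡ k →
                    below n k ℕ.+ below n k ℕ.≤ below n (k ℕ.+ i) ℕ.+ below n l
  below-symmetric {n} h zero k refl =
    ℕ.≤-reflexive (cong (λ j → below n j ℕ.+ below n k) (sym (ℕ.+-identityʳ k)))
  below-symmetric {n} {k} h (suc i) l refl = begin
    below n k ℕ.+ below n k
      ≤⟨ below-symmetric h i (suc l) (ℕ.+-suc i l) ⟩
    below n (k ℕ.+ i) ℕ.+ below n (suc l)
      ≡⟨ cong (below n (k ℕ.+ i) ℕ.+_) (trans (below-suc n l) (ℕ.+-comm (below n l) (exactly n l))) ⟩
    below n (k ℕ.+ i) ℕ.+ (exactly n l ℕ.+ below n l)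
      ≡⟨ ℕ.+-assoc (below n (k ℕ.+ i)) (exactly n l) (below n l) ⟨
    below n (k ℕ.+ i) ℕ.+ exactly n l ℕ.+ below n l
      ≤⟨ ℕ.+-monoˡ-≤ (below n l) (ℕ.+-monoʳ-≤ (below n (k ℕ.+ i))
           (reflect (n ℕ.∸ k) (ℕ.m+[n∸m]≡n k≤n) ka≤n∸k i l refl)) ⟩
    below n (k ℕ.+ i) ℕ.+ exactly n (k ℕ.+ i) ℕ.+ below n l
      ≡⟨ cong (ℕ._+ below n l) (trans (cong (below n) (ℕ.+-suc k i)) (below-suc n (k ℕ.+ i))) ⟨
    below n (k ℕ.+ suc i) ℕ.+ below n l ∎
    where
    open ℕ.≤-Reasoning
    k+ka≤n : k ℕ.+ k ℕ.* a ℕ.≤ n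
    k+ka≤n = subst (ℕ._≤ n) (ℕ.*-suc k a) h

    k≤n : k ℕ.≤ n
    k≤n = ℕ.m+n≤o⇒m≤o k k+ka≤n

    ka≤n∸k : k ℕ.* a ℕ.≤ n ℕ.∸ k
    ka≤n∸k = ℕ.m+n≤o⇒m≤o∸n (k ℕ.* a) (subst (ℕ._≤ n) (ℕ.+-comm k (k ℕ.* a)) k+ka≤n)

  below-twice : ∀ {n k} → k ℕ.* suc a ℕ.≤ n → below n k ℕ.+ below n k ℕ.≤ below n (k ℕ.+ k)
  below-twice {n} {k} h = ℕ.≤-trans (below-symmetric h k 0 (ℕ.+-identityʳ k))
    (ℕ.≤-reflexive (ℕ.+-identityʳ (below n (k ℕ.+ k))))

-- Counting vectors

module _ {A : Set} {P : Pred A 0ℓ} (P? : Decidable P) where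

  length-filter-map : ∀ {B : Set} (f : B → A) xs →
                      length (filter P? (map f xs)) ≡ length (filter (P? ∘ f) xs)
  length-filter-map f []       = refl
  length-filter-map f (x ∷ xs) with does (P? (f x))
  ... | true  = cong suc (length-filter-map f xs)
  ... | false = length-filter-map f xs

  length-filter-++ : ∀ xs ys →
    length (filter P? (xs ++ ys)) ≡ length (filter P? xs) ℕ.+ length (filter P? ys)
  length-filter-++ xs ys = trans (cong length (List.filter-++ P? xs ys))
    (List.length-++ (filter P? xs))

  length-filter-filter : ∀ {Q : Pred A 0ℓ} (Q? : Decidable Q) xs →
                         length (filter P? (filter Q? xs)) ℕ.≤ length (filter P? xs)
  length-filter-filter Q? []       = z≤n
  length-filter-filter Q? (x ∷ xs) with does (Q? x)
  ... | false with does (P? x)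
  ...   | false = length-filter-filter Q? xs
  ...   | true  = ℕ.m≤n⇒m≤1+n (length-filter-filter Q? xs)
  length-filter-filter Q? (x ∷ xs) | true with does (P? x)
  ...   | false = length-filter-filter Q? xs
  ...   | true  = s≤s (length-filter-filter Q? xs)

length-filter-⊆ : ∀ {A : Set} {P Q : Pred A 0ℓ} (P? : Decidable P) (Q? : Decidable Q) → P ⊆ Q →
                  ∀ xs → length (filter P? xs) ℕ.≤ length (filter Q? xs)
length-filter-⊆ P? Q? P⊆Q []       = z≤n
length-filter-⊆ P? Q? P⊆Q (x ∷ xs) with P? x | Q? x
... | yes p | no ¬q = contradiction (P⊆Q p) ¬q
... | yes p | yes q = s≤s (length-filter-⊆ P? Q? P⊆Q xs)
... | no ¬p | yes q = ℕ.m≤n⇒m≤1+n (length-filter-⊆ P? Q? P⊆Q xs)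
... | no ¬p | no ¬q = length-filter-⊆ P? Q? P⊆Q xs

length-filter-complement : ∀ {A : Set} {P Q : Pred A 0ℓ} (P? : Decidable P) (Q? : Decidable Q) →
  (∀ {x} → P x → ¬ Q x) → (∀ {x} → ¬ P x → Q x) →
  ∀ xs → length (filter P? xs) ℕ.+ length (filter Q? xs) ≡ length xs
length-filter-complement P? Q? P⇒¬Q ¬P⇒Q []       = refl
length-filter-complement P? Q? P⇒¬Q ¬P⇒Q (x ∷ xs) with P? x | Q? x
... | yes p | yes q = contradiction q (P⇒¬Q p)
... | yes p | no ¬q = cong suc (length-filter-complement P? Q? P⇒¬Q ¬P⇒Q xs)
... | no ¬p | yes q = trans (ℕ.+-suc _ _) (cong suc (length-filter-complement P? Q? P⇒¬Q ¬P⇒Q xs))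
... | no ¬p | no ¬q = contradiction (¬P⇒Q ¬p) ¬q

vectors : ∀ {A : Set} → List A → ∀ n → List (Vec A n)
vectors us zero    = [] ∷ []
vectors us (suc n) = cartesianProductWith _∷_ us (vectors us n)

vectors-unique : ∀ {A : Set} {us : List A} → Unique us → ∀ n → Unique (vectors us n)
vectors-unique us! zero    = [] ∷ []
vectors-unique us! (suc n) =
  Unique.cartesianProductWith⁺ _∷_ Vec.∷-injective us! (vectors-unique us! n)

length-cartesianProductWith : ∀ {A B C : Set} (f : A → B → C) xs ys →
                              length (cartesianProductWith f xs ys) ≡ length xs ℕ.* length ys
length-cartesianProductWith f []       ys = refl
length-cartesianProductWith f (x ∷ xs) ys = trans (List.length-++ (map (f x) ys))
  (cong₂ ℕ._+_ (List.length-map (f x) ys) (length-cartesianProductWith f xs ys))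

length-vectors : ∀ {A : Set} (us : List A) n → length (vectors us n) ≡ length us ℕ.^ n
length-vectors us zero    = refl
length-vectors us (suc n) = trans (length-cartesianProductWith _∷_ us (vectors us n))
  (cong (length us ℕ.*_) (length-vectors us n))

module _ {A B C : Set} (f : A → B → C) {P : Pred C 0ℓ} (P? : Decidable P)
         {Q : Pred B 0ℓ} (Q? : Decidable Q) (ys : List B) where

  length-filter-cartesian : ∀ {xs} → All (λ x → ∀ y → P (f x y) → Q y) xs →
    length (filter P? (cartesianProductWith f xs ys)) ℕ.≤ length xs ℕ.* length (filter Q? ys)
  length-filter-cartesian []                    = z≤n
  length-filter-cartesian {x ∷ xs} (P⇒Q ∷ rest) = begin
    length (filter P? (map (f x) ys ++ cartesianProductWith f xs ys))
      ≡⟨ length-filter-++ P? (map (f x) ys) _ ⟩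
    length (filter P? (map (f x) ys)) ℕ.+ length (filter P? (cartesianProductWith f xs ys))
      ≡⟨ cong (ℕ._+ _) (length-filter-map P? (f x) ys) ⟩
    length (filter (P? ∘ f x) ys) ℕ.+ length (filter P? (cartesianProductWith f xs ys))
      ≤⟨ ℕ.+-mono-≤ (length-filter-⊆ (P? ∘ f x) Q? (P⇒Q _) ys) (length-filter-cartesian rest) ⟩
    length (filter Q? ys) ℕ.+ length xs ℕ.* length (filter Q? ys) ∎
    where open ℕ.≤-Reasoning

  -- A hit forces the first coordinate to be `u`, which occurs at most once in `xs`; hence at most
  -- one x contributes, and its hits all satisfy `Q`.
  length-filter-cartesian-unique : DecidableEquality A →
    ∀ {u xs} → Unique xs → (∀ x y → P (f x y) → x ≡ u × Q y) →
    length (filter P? (cartesianProductWith f xs ys)) ℕ.≤ length (filter Q? ys)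
  length-filter-cartesian-unique _≟_ {u} {[]}     []           P⇒ = z≤n
  length-filter-cartesian-unique _≟_ {u} {x ∷ xs} (x∉xs ∷ xs!) P⇒ = begin
    length (filter P? (map (f x) ys ++ cartesianProductWith f xs ys))
      ≡⟨ length-filter-++ P? (map (f x) ys) _ ⟩
    length (filter P? (map (f x) ys)) ℕ.+ length (filter P? (cartesianProductWith f xs ys))
      ≡⟨ cong (ℕ._+ _) (length-filter-map P? (f x) ys) ⟩
    length (filter (P? ∘ f x) ys) ℕ.+ length (filter P? (cartesianProductWith f xs ys))
      ≤⟨ split (x ≟ u) ⟩
    length (filter Q? ys) ∎
    where
    open ℕ.≤-Reasoning
    split : Dec (x ≡ u) →
            length (filter (P? ∘ f x) ys) ℕ.+ length (filter P? (cartesianProductWith f xs ys))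
            ℕ.≤ length (filter Q? ys)
    -- Once the head is `u`, uniqueness leaves no hit in the tail.
    split (yes refl) = ℕ.≤-trans
      (ℕ.≤-reflexive (trans (cong (λ zs → length (filter (P? ∘ f x) ys) ℕ.+ length zs)
        (List.filter-none P? (All.cartesianProductWith⁺ (setoid A) (setoid B) f xs ys
          λ v∈xs _ p → All.lookup x∉xs v∈xs (sym (proj₁ (P⇒ _ _ p))))))
        (ℕ.+-identityʳ _)))
      (length-filter-⊆ (P? ∘ f x) Q? (λ p → proj₂ (P⇒ _ _ p)) ys)
    split (no x≢u) = ℕ.≤-trans
      (ℕ.≤-reflexive (cong (λ zs → length zs ℕ.+ _)
        (List.filter-none (P? ∘ f x) (All.universal (λ y p → x≢u (proj₁ (P⇒ x y p))) ys))))
      (length-filter-cartesian-unique _≟_ xs! P⇒)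

module _ {A : Set} (_≟_ : DecidableEquality A) where

  private
    _≟*_ : ∀ {k} → DecidableEquality (Vec A k)
    _≟*_ = Vec.≡-dec _≟_

  -- A coordinate outside `J` contributes a factor `length us` to the fibre, one in `J` at most a
  -- factor 1. Equality can fail because `α` may have entries outside `us`.
  fibre-size : ∀ {us} → Unique us → ∀ {N} (J : Subset N) α →
    length (filter (λ y → restrict J y ≟* α) (vectors us N)) ℕ.* length us ℕ.^ ∣ J ∣ ℕ.≤ length us ℕ.^ N
  fibre-size us! [] α = ℕ.≤-trans (ℕ.≤-reflexive (ℕ.*-identityʳ _))
    (List.length-filter (λ y → restrict [] y ≟* α) ([] ∷ []))
  fibre-size {us} us! {suc N} (inside ∷ J) (u ∷ α) = begin
    length (filter P? (vectors us (suc N))) ℕ.* (M ℕ.* M ℕ.^ ∣ J ∣)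
      ≤⟨ ℕ.*-monoˡ-≤ (M ℕ.* M ℕ.^ ∣ J ∣)
           (length-filter-cartesian-unique _∷_ P? (λ y → restrict J y ≟* α) (vectors us N)
             _≟_ us! λ _ _ → Vec.∷-injective) ⟩
    F ℕ.* (M ℕ.* M ℕ.^ ∣ J ∣)
      ≡⟨ swap F M (M ℕ.^ ∣ J ∣) ⟩
    M ℕ.* (F ℕ.* M ℕ.^ ∣ J ∣)
      ≤⟨ ℕ.*-monoʳ-≤ M (fibre-size us! J α) ⟩
    M ℕ.* M ℕ.^ N ∎
    where
    open ℕ.≤-Reasoning
    M = length us
    F = length (filter (λ y → restrict J y ≟* α) (vectors us N))
    P? = λ y → restrict (inside ∷ J) y ≟* (u ∷ α)
    swap : ∀ x y z → x ℕ.* (y ℕ.* z) ≡ y ℕ.* (x ℕ.* z)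
    swap = solve 3 (λ x y z → x :* (y :* z) := y :* (x :* z)) refl
      where open ℕ-Solver
  fibre-size {us} us! {suc N} (outside ∷ J) α = begin
    length (filter P? (vectors us (suc N))) ℕ.* M ℕ.^ ∣ J ∣
      ≤⟨ ℕ.*-monoˡ-≤ (M ℕ.^ ∣ J ∣)
           (length-filter-cartesian _∷_ P? (λ y → restrict J y ≟* α) (vectors us N)
             (All.universal (λ _ _ → id) us)) ⟩
    M ℕ.* F ℕ.* M ℕ.^ ∣ J ∣
      ≡⟨ ℕ.*-assoc M F (M ℕ.^ ∣ J ∣) ⟩
    M ℕ.* (F ℕ.* M ℕ.^ ∣ J ∣)
      ≤⟨ ℕ.*-monoʳ-≤ M (fibre-size us! J α) ⟩
    M ℕ.* M ℕ.^ N ∎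
    where
    open ℕ.≤-Reasoning
    M = length us
    F = length (filter (λ y → restrict J y ≟* α) (vectors us N))
    P? = λ y → restrict (outside ∷ J) y ≟* α

  module _ (c : A) where

    occurrences : ∀ {n} → Vec A n → ℕ
    occurrences = count (_≟ c)

    occurrences-hit : ∀ {n} (y : Vec A n) → occurrences (c ∷ y) ≡ suc (occurrences y)
    occurrences-hit y with c ≟ c
    ... | yes _   = refl
    ... | no  c≢c = contradiction refl c≢c

    occurrences-miss : ∀ {n v} (y : Vec A n) → c ≢ v → occurrences (v ∷ y) ≡ occurrences y
    occurrences-miss {v = v} y c≢v with v ≟ c
    ... | yes v≡c = contradiction (sym v≡c) c≢v
    ... | no  _   = refl

    occurrences-∷ : ∀ {n} v (y : Vec A n) → occurrences (v ∷ y) ℕ.≤ suc (occurrences y)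
    occurrences-∷ v y with does (v ≟ c)
    ... | true  = ℕ.≤-refl
    ... | false = ℕ.n≤1+n _

    frequent : List A → ∀ n → ℕ → List (Vec A n)
    frequent us n k = filter (λ y → k ℕ.≤? occurrences y) (vectors us n)

    module _ {vs : List A} (c∉vs : All (c ≢_) vs) where

      open Binomial (length vs)

      -- Splitting on the first entry reproduces the recursion of `below`: after `c` only fewer than
      -- k further occurrences are allowed, after any entry of `vs` the bound is unchanged.
      rare-size : ∀ n k →
        length (filter (λ y → occurrences y ℕ.<? k) (vectors (c ∷ vs) n)) ℕ.≤ below n k
      rare-size n zero = ℕ.≤-reflexive (cong length
        (List.filter-none (λ y → occurrences y ℕ.<? 0) (All.universal (λ _ ()) (vectors (c ∷ vs) n))))
      rare-size zero (suc k) = List.length-filter (λ y → occurrences y ℕ.<? suc k) ([] ∷ [])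
      rare-size (suc n) (suc k) = begin
        length (filter P? (map (c ∷_) ys ++ cartesianProductWith _∷_ vs ys))
          ≡⟨ length-filter-++ P? (map (c ∷_) ys) _ ⟩
        length (filter P? (map (c ∷_) ys)) ℕ.+ length (filter P? (cartesianProductWith _∷_ vs ys))
          ≡⟨ cong (ℕ._+ length (filter P? (cartesianProductWith _∷_ vs ys))) (length-filter-map P? (c ∷_) ys) ⟩
        length (filter (P? ∘ (c ∷_)) ys) ℕ.+ length (filter P? (cartesianProductWith _∷_ vs ys))
          ≤⟨ ℕ.+-mono-≤
               (length-filter-⊆ (P? ∘ (c ∷_)) (λ y → occurrences y ℕ.<? k)
                 (λ {y} p → ℕ.s≤s⁻¹ (subst (ℕ._< suc k) (occurrences-hit y) p)) ys)
               (length-filter-cartesian _∷_ P? (λ y → occurrences y ℕ.<? suc k) ys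
                 (All.map (λ c≢v y → subst (ℕ._< suc k) (occurrences-miss y c≢v)) c∉vs)) ⟩
        length (filter (λ y → occurrences y ℕ.<? k) ys)
          ℕ.+ length vs ℕ.* length (filter (λ y → occurrences y ℕ.<? suc k) ys)
          ≤⟨ ℕ.+-mono-≤ (rare-size n k) (ℕ.*-monoʳ-≤ (length vs) (rare-size n (suc k))) ⟩
        below n k ℕ.+ length vs ℕ.* below n (suc k) ∎
        where
        open ℕ.≤-Reasoning
        ys = vectors (c ∷ vs) n
        P? = λ y → occurrences y ℕ.<? suc k

    -- With S frequent and R rare vectors, 2R ≤ 2 `below n k` ≤ `below n (k + k)` ≤ M^n = S + R.
    -- Adding R to both sides of the claim lets the chain run without subtraction.
    frequent-majority : ∀ {vs} → All (c ≢_) vs → ∀ {n k} →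
      let us = c ∷ vs in 1 ℕ.< length us → k ℕ.* length us ℕ.≤ n →
      length us ℕ.^ n ℕ.≤ 2 ℕ.* length (frequent us n k)
    -- An alphabet with a second letter gives the positive `a` over which `Median` works.
    frequent-majority {[]}     c∉ (s≤s ()) h
    frequent-majority {v ∷ vs} c∉ {n} {k} _ h = ℕ.+-cancelʳ-≤ R _ _ (begin
      M ℕ.^ n ℕ.+ R                  ≡⟨ cong (ℕ._+ R) partition ⟩
      S ℕ.+ R ℕ.+ R                  ≡⟨ ℕ.+-assoc S R R ⟩
      S ℕ.+ (R ℕ.+ R)                ≤⟨ ℕ.+-monoʳ-≤ S (ℕ.+-mono-≤ (rare-size c∉ n k) (rare-size c∉ n k)) ⟩
      S ℕ.+ (below n k ℕ.+ below n k) ≤⟨ ℕ.+-monoʳ-≤ S (below-twice {k = k} h) ⟩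
      S ℕ.+ below n (k ℕ.+ k)        ≤⟨ ℕ.+-monoʳ-≤ S (below≤^ n (k ℕ.+ k)) ⟩
      S ℕ.+ M ℕ.^ n                  ≡⟨ cong (S ℕ.+_) partition ⟩
      S ℕ.+ (S ℕ.+ R)                ≡⟨ solve 2 (λ s r → s :+ (s :+ r) := con 2 :* s :+ r) refl S R ⟩
      2 ℕ.* S ℕ.+ R                  ∎)
      where
      open ℕ.≤-Reasoning
      open ℕ-Solver
      open Binomial (length (v ∷ vs))
      open Median (length vs)
      M = length (c ∷ v ∷ vs)
      S = length (frequent (c ∷ v ∷ vs) n k)
      R = length (filter (λ y → occurrences y ℕ.<? k) (vectors (c ∷ v ∷ vs) n))
      partition : M ℕ.^ n ≡ S ℕ.+ R
      partition = sym (trans (length-filter-complement (λ y → k ℕ.≤? occurrences y)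
        (λ y → occurrences y ℕ.<? k) ℕ.≤⇒≯ ℕ.≰⇒> (vectors (c ∷ v ∷ vs) n))
        (length-vectors (c ∷ v ∷ vs) n))

-- Binary words and all-ones blocks

words : ∀ m → List (Vec Bool m)
words = vectors (true ∷ false ∷ [])

words-unique : ∀ m → Unique (words m)
words-unique = vectors-unique (((λ ()) ∷ []) ∷ [] ∷ [])

-- `true` is listed before `false`, so the all-ones word comes first; this is the shape `c ∷ vs` in
-- which `frequent-majority` takes its alphabet.
words-ones : ∀ m → ∃ λ vs → words m ≡ replicate m true ∷ vs
words-ones zero    = [] , refl
words-ones (suc m) with words m | words-ones m
... | _ | vs , refl = _ , refl

_≟ʷ_ : ∀ {m} → DecidableEquality (Vec Bool m)
_≟ʷ_ = Vec.≡-dec Bool._≟_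

full : ∀ {m n} → Vec (Vec Bool m) n → ℕ
full {m} = occurrences _≟ʷ_ (replicate m true)

-- At an index outside `I` the block has a 0 at the position that x selects, so it is not all ones.
-- All-ones blocks therefore sit only at indices in `I`.
zero-outside⇒full≤ : ∀ {m N} (I : Subset N) (x : Vec (Fin m) N) (y : Vec (Vec Bool m) N) →
  replicate ∣ ∁ I ∣ false ≡ restrict (∁ I) (zipWith IND x y) → full y ℕ.≤ ∣ I ∣
zero-outside⇒full≤ []            []       []       eq = z≤n
zero-outside⇒full≤ (inside ∷ I)  (i ∷ x)  (v ∷ y)  eq =
  ℕ.≤-trans (occurrences-∷ _≟ʷ_ _ v y) (s≤s (zero-outside⇒full≤ I x y eq))
zero-outside⇒full≤ {m} (outside ∷ I) (i ∷ x)  (v ∷ y)  eq =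
  ℕ.≤-trans (ℕ.≤-reflexive (occurrences-miss _≟ʷ_ (replicate m true) y v≢1))
    (zero-outside⇒full≤ I x y (Vec.∷-injectiveʳ eq))
  where
  v≢1 : replicate m true ≢ v
  v≢1 refl = contradiction (trans (Vec.∷-injectiveˡ eq) (Vec.lookup-replicate i true)) λ ()

-- Rationals and logarithms

⌜_⌝ : ℕ → ℚ
⌜ n ⌝ = + n ℚ./ 1

private
  toℚᵘ-/ : ∀ n d → ℚ.toℚᵘ (n ℚ./ suc d) ℚᵘ.≃ mkℚᵘ n d
  toℚᵘ-/ n d = ℚ.toℚᵘ-fromℚᵘ (mkℚᵘ n d)

/-monoˡ-≤ : ∀ {a b} d → a ℕ.≤ b → + a ℚ./ suc d ℚ.≤ + b ℚ./ suc d
/-monoˡ-≤ {a} {b} d a≤b = ℚ.toℚᵘ-cancel-≤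
  (ℚᵘ.≤-respˡ-≃ (ℚᵘ.≃-sym (toℚᵘ-/ (+ a) d)) (ℚᵘ.≤-respʳ-≃ (ℚᵘ.≃-sym (toℚᵘ-/ (+ b) d))
    (ℚᵘ.*≤* (ℤ.*-monoʳ-≤-nonNeg (+ suc d) (ℤ.+≤+ a≤b)))))

/-+ : ∀ a e d → + (a ℕ.+ e ℕ.* suc d) ℚ./ suc d ≡ + a ℚ./ suc d ℚ.+ ⌜ e ⌝
/-+ a e d = ℚ.toℚᵘ-injective (ℚᵘ.≃-trans (toℚᵘ-/ (+ (a ℕ.+ e ℕ.* suc d)) d)
  (ℚᵘ.≃-trans (ℚᵘ.*≡* cross)
    (ℚᵘ.≃-sym (ℚᵘ.≃-trans (ℚ.toℚᵘ-homo-+ (+ a ℚ./ suc d) ⌜ e ⌝)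
      (ℚᵘ.+-cong (toℚᵘ-/ (+ a) d) (toℚᵘ-/ (+ e) 0))))))
  where
  open ℤ-Solver
  cross : + (a ℕ.+ e ℕ.* suc d) ℤ.* (+ suc d ℤ.* + 1) ≡ (+ a ℤ.* + 1 ℤ.+ + e ℤ.* + suc d) ℤ.* + suc d
  cross = trans
    (cong (ℤ._* (+ suc d ℤ.* + 1)) (trans (ℤ.pos-+ a (e ℕ.* suc d)) (cong (λ z → + a ℤ.+ z) (ℤ.pos-* e (suc d)))))
    (solve 3 (λ a e d → (a :+ e :* d) :* (d :* con (+ 1)) := (a :* con (+ 1) :+ e :* d) :* d) refl
      (+ a) (+ e) (+ suc d))

/-* : ∀ a d → (+ a ℚ./ suc d) ℚ.* ⌜ suc d ⌝ ≡ ⌜ a ⌝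
/-* a d = ℚ.toℚᵘ-injective (ℚᵘ.≃-trans (ℚ.toℚᵘ-homo-* (+ a ℚ./ suc d) ⌜ suc d ⌝)
  (ℚᵘ.≃-trans (ℚᵘ.*-cong (toℚᵘ-/ (+ a) d) (toℚᵘ-/ (+ suc d) 0))
    (ℚᵘ.≃-trans (ℚᵘ.*≡* cross) (ℚᵘ.≃-sym (toℚᵘ-/ (+ a) 0)))))
  where
  open ℤ-Solver
  cross : (+ a ℤ.* + suc d) ℤ.* + 1 ≡ + a ℤ.* (+ suc d ℤ.* + 1)
  cross = solve 2 (λ a d → (a :* d) :* con (+ 1) := a :* (d :* con (+ 1))) refl (+ a) (+ suc d)

⌜⌝-mono-≤ : ∀ {a b} → a ℕ.≤ b → ⌜ a ⌝ ℚ.≤ ⌜ b ⌝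
⌜⌝-mono-≤ = /-monoˡ-≤ 0

⌜⌝-cancel-< : ∀ {a b} → ⌜ a ⌝ ℚ.< ⌜ b ⌝ → a ℕ.< b
⌜⌝-cancel-< a<b = ℕ.≰⇒> λ b≤a → ℚ.<-irrefl refl (ℚ.<-≤-trans a<b (⌜⌝-mono-≤ b≤a))

⌜⌝-+ : ∀ a b → ⌜ a ℕ.+ b ⌝ ≡ ⌜ a ⌝ ℚ.+ ⌜ b ⌝
⌜⌝-+ a b = trans (cong (λ n → ⌜ a ℕ.+ n ⌝) (sym (ℕ.*-identityʳ b))) (/-+ a b 0)

⌜⌝-* : ∀ a b → ⌜ a ℕ.* b ⌝ ≡ ⌜ a ⌝ ℚ.* ⌜ b ⌝
⌜⌝-* zero    b = sym (ℚ.*-zeroˡ ⌜ b ⌝)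
⌜⌝-* (suc a) b = trans (⌜⌝-+ b (a ℕ.* b)) (trans (cong (⌜ b ⌝ ℚ.+_) (⌜⌝-* a b))
  (trans (solve 2 (λ x y → y :+ x :* y := (con 1ℚ :+ x) :* y) refl ⌜ a ⌝ ⌜ b ⌝)
    (cong (ℚ._* ⌜ b ⌝) (sym (⌜⌝-+ 1 a)))))
  where open ℚ-Solver

-- The logarithms that occur here can be compared approximant by approximant, so the analysis
-- reduces to rational inequalities at each index.
pointwise⇒≤ : ∀ x y → (∀ k → seq x k ℚ.≤ seq y k) → x ≤ y
pointwise⇒≤ x y h ε ε>0 = 0 , λ k _ → ℚ.≤-trans (h k)
  (ℚ.≤-trans (ℚ.≤-reflexive (sym (ℚ.+-identityʳ (seq y k)))) (ℚ.+-monoʳ-≤ (seq y k) (ℚ.<⇒≤ ε>0)))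

^-distribʳ-* : ∀ e m n → (m ℕ.* n) ℕ.^ e ≡ m ℕ.^ e ℕ.* n ℕ.^ e
^-distribʳ-* zero    m n = refl
^-distribʳ-* (suc e) m n = trans (cong (m ℕ.* n ℕ.*_) (^-distribʳ-* e m n))
  (solve 4 (λ m n x y → m :* n :* (x :* y) := m :* x :* (n :* y)) refl m n (m ℕ.^ e) (n ℕ.^ e))
  where open ℕ-Solver

n*2^e≢0 : ∀ n .{{_ : ℕ.NonZero n}} e → ℕ.NonZero (n ℕ.* 2 ℕ.^ e)
n*2^e≢0 n e = ℕ.m*n≢0 n (2 ℕ.^ e)
  where instance _ = ℕ.m^n≢0 2 e

⌊log₂[n*2^e]⌋ : ∀ n .{{_ : ℕ.NonZero n}} e → ⌊log₂ n ℕ.* 2 ℕ.^ e ⌋ ≡ ⌊log₂ n ⌋ ℕ.+ e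
⌊log₂[n*2^e]⌋ n zero    = trans (cong ⌊log₂_⌋ (ℕ.*-identityʳ n)) (sym (ℕ.+-identityʳ _))
⌊log₂[n*2^e]⌋ n (suc e) = trans
  (cong ⌊log₂_⌋ (solve 2 (λ n p → n :* (con 2 :* p) := con 2 :* (n :* p)) refl n (2 ℕ.^ e)))
  (trans (⌊log₂[2*b]⌋≡1+⌊log₂b⌋ (n ℕ.* 2 ℕ.^ e) {{n*2^e≢0 n e}})
    (trans (cong suc (⌊log₂[n*2^e]⌋ n e)) (sym (ℕ.+-suc _ e))))
  where open ℕ-Solver

seq-log₂ℕ : ∀ n .{{_ : ℕ.NonZero n}} k → seq (log₂ℕ n) k ≡ + ⌊log₂ n ℕ.^ suc k ⌋ ℚ./ suc k
seq-log₂ℕ (suc n) k = refl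

log₂ℕ-mono : ∀ {m n} .{{_ : ℕ.NonZero m}} → m ℕ.≤ n → ∀ k → seq (log₂ℕ m) k ℚ.≤ seq (log₂ℕ n) k
log₂ℕ-mono {suc m} {suc n} m≤n k = /-monoˡ-≤ k (⌊log₂⌋-mono-≤ (ℕ.^-monoˡ-≤ (suc k) m≤n))

-- The factor 2^e becomes 2^(e(k+1)) in the (k+1)-st power and passes through the floor exactly, so
-- dividing by k + 1 leaves a shift by e at every index, not only in the limit.
log₂ℕ-shift : ∀ n .{{_ : ℕ.NonZero n}} e k →
              seq (log₂ℕ (n ℕ.* 2 ℕ.^ e)) k ≡ seq (log₂ℕ n) k ℚ.+ ⌜ e ⌝
log₂ℕ-shift n e k = trans
  (seq-log₂ℕ (n ℕ.* 2 ℕ.^ e) {{n*2^e≢0 n e}} k)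
  (trans (cong (λ l → + l ℚ./ suc k)
      (trans (cong ⌊log₂_⌋ (trans (^-distribʳ-* (suc k) n (2 ℕ.^ e))
               (cong (n ℕ.^ suc k ℕ.*_) (ℕ.^-*-assoc 2 e (suc k)))))
             (⌊log₂[n*2^e]⌋ (n ℕ.^ suc k) {{ℕ.m^n≢0 n (suc k)}} (e ℕ.* suc k))))
    (trans (/-+ ⌊log₂ n ℕ.^ suc k ⌋ e k) (cong (ℚ._+ ⌜ e ⌝) (sym (seq-log₂ℕ n k)))))

log₂ℕ-1 : ∀ k → seq (log₂ℕ 1) k ≡ 0ℚ
log₂ℕ-1 k = trans (cong (λ n → + ⌊log₂ n ⌋ ℚ./ suc k) (ℕ.^-zeroˡ (suc k)))
  (ℚ.0/n≡0 (suc k))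

log₂ℕ-2^ : ∀ e k → seq (log₂ℕ (2 ℕ.^ e)) k ≡ ⌜ e ⌝
log₂ℕ-2^ e k = trans (cong (λ n → seq (log₂ℕ n) k) (sym (ℕ.*-identityˡ (2 ℕ.^ e))))
  (trans (log₂ℕ-shift 1 e k) (trans (cong (ℚ._+ ⌜ e ⌝) (log₂ℕ-1 k)) (ℚ.+-identityˡ ⌜ e ⌝)))

-- For p in lowest terms the bound says that numerator times 2^e is at most the denominator;
-- monotonicity and the exact shift then apply termwise.
log₂-≤ : ∀ p e → 0ℚ ℚ.< p → p ℚ.* ⌜ 2 ℕ.^ e ⌝ ℚ.≤ 1ℚ → ∀ k → seq (log₂ p) k ℚ.≤ ℚ.- ⌜ e ⌝
log₂-≤ (mkℚ (+ 0) d c) e (ℚ.*<* (ℤ.+<+ ()))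
log₂-≤ (mkℚ (ℤ.-[1+ n ]) d c) e (ℚ.*<* ())
log₂-≤ p@(mkℚ +[1+ n ] d c) e _ h k = begin
  seq (log₂ℕ (suc n)) k ℚ.- seq (log₂ℕ (suc d)) k
    ≤⟨ ℚ.+-monoʳ-≤ (seq (log₂ℕ (suc n)) k) (ℚ.neg-antimono-≤
         (subst (ℚ._≤ seq (log₂ℕ (suc d)) k) (log₂ℕ-shift (suc n) e k)
           (log₂ℕ-mono {{n*2^e≢0 (suc n) e}} n2^e≤d k))) ⟩
  seq (log₂ℕ (suc n)) k ℚ.- (seq (log₂ℕ (suc n)) k ℚ.+ ⌜ e ⌝)
    ≡⟨ solve 2 (λ x y → x :- (x :+ y) := :- y) refl (seq (log₂ℕ (suc n)) k) ⌜ e ⌝ ⟩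
  ℚ.- ⌜ e ⌝ ∎
  where
  open ℚ.≤-Reasoning
  open ℚ-Solver
  n2^e≤d : suc n ℕ.* 2 ℕ.^ e ℕ.≤ suc d
  n2^e≤d with ℚᵘ.≤-respˡ-≃ (ℚᵘ.≃-trans (ℚ.toℚᵘ-homo-* p ⌜ 2 ℕ.^ e ⌝)
                (ℚᵘ.*-congˡ {mkℚᵘ +[1+ n ] d} (toℚᵘ-/ (+ (2 ℕ.^ e)) 0))) (ℚ.toℚᵘ-mono-≤ h)
  ... | ℚᵘ.*≤* q = ℤ.drop‿+≤+ (subst₂ ℤ._≤_
    (trans (ℤ.*-identityʳ _) (sym (ℤ.pos-* (suc n) (2 ℕ.^ e))))
    (trans (ℤ.*-identityˡ _) (cong +_ (ℕ.*-identityʳ (suc d)))) q)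

seq-sumℝ-const : ∀ {V : Set} (f : V → ℝ) q k → (∀ v → seq (f v) k ≡ q) →
                 ∀ vs → seq (sumℝ (map f vs)) k ≡ ⌜ length vs ⌝ ℚ.* q
seq-sumℝ-const f q k eq []       = sym (ℚ.*-zeroˡ q)
seq-sumℝ-const f q k eq (v ∷ vs) = trans (cong₂ ℚ._+_ (eq v) (seq-sumℝ-const f q k eq vs))
  (trans (solve 2 (λ a n → a :+ n :* a := (con 1ℚ :+ n) :* a) refl q ⌜ length vs ⌝)
    (cong (ℚ._* q) (sym (⌜⌝-+ 1 (length vs)))))
  where open ℚ-Solver

sumℚ-const : ∀ {V : Set} q (vs : List V) → sumℚ (map (λ _ → q) vs) ≡ ⌜ length vs ⌝ ℚ.* q
sumℚ-const q []       = sym (ℚ.*-zeroˡ q)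
sumℚ-const q (v ∷ vs) = trans (cong (q ℚ.+_) (sumℚ-const q vs))
  (trans (solve 2 (λ a n → a :+ n :* a := (con 1ℚ :+ n) :* a) refl q ⌜ length vs ⌝)
    (cong (ℚ._* q) (sym (⌜⌝-+ 1 (length vs)))))
  where open ℚ-Solver

-- `log₂` reads off the reduced numerator and denominator, and 1/n is already reduced.
seq-log₂-1/ : ∀ n .{{_ : ℕ.NonZero n}} k → seq (log₂ (+ 1 ℚ./ n)) k ≡ ℚ.- seq (log₂ℕ n) k
seq-log₂-1/ (suc n) k = trans (cong (λ p → seq (log₂ p) k) (ℚ.normalize-coprime (ℕ.1-coprimeTo (suc n))))
  (trans (cong (ℚ._- seq (log₂ℕ (suc n)) k) (log₂ℕ-1 k)) (ℚ.+-identityˡ _))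

1/n*n : ∀ n .{{_ : ℕ.NonZero n}} → (+ 1 ℚ./ n) ℚ.* ⌜ n ⌝ ≡ 1ℚ
1/n*n (suc n) = /-* 1 n

cancel-inverse : ∀ n i l → i ℚ.* n ≡ 1ℚ → n ℚ.* (ℚ.- (i ℚ.* (ℚ.- l))) ≡ l
cancel-inverse n i l eq = trans (regroup n i l) (trans (cong (ℚ._* l) eq) (ℚ.*-identityˡ l))
  where
  open ℚ-Solver
  regroup : ∀ n i l → n ℚ.* (ℚ.- (i ℚ.* (ℚ.- l))) ≡ (i ℚ.* n) ℚ.* l
  regroup = solve 3 (λ n i l → n :* (:- (i :* (:- l))) := (i :* n) :* l) refl

seq-entropy-uniform : ∀ {V} (S : FinSet V) .{{_ : ℕ.NonZero (card S)}} k →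
                      seq (entropy (uniform S)) k ≡ seq (log₂ℕ (card S)) k
seq-entropy-uniform S k = trans
  (seq-sumℝ-const _ (ℚ.- ((+ 1 ℚ./ card S) ℚ.* (ℚ.- seq (log₂ℕ (card S)) k))) k
    (λ _ → cong (λ l → ℚ.- ((+ 1 ℚ./ card S) ℚ.* l)) (seq-log₂-1/ (card S) k)) (elements S))
  (cancel-inverse ⌜ card S ⌝ (+ 1 ℚ./ card S) (seq (log₂ℕ (card S)) k) (1/n*n (card S)))

-- Uniform distributions

Pr-uniform : ∀ {V} {P : Pred V 0ℓ} (S : FinSet V) .{{S≢∅ : ℕ.NonZero (card S)}} (P? : Decidable P) →
  Pr (uniform S {{S≢∅}}) P? ℚ.* ⌜ card S ⌝ ≡ ⌜ length (filter P? (elements S)) ⌝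
Pr-uniform S {{S≢∅}} P? = trans
  (cong (ℚ._* ⌜ card S ⌝) (sumℚ-const (+ 1 ℚ./ card S) (filter P? (elements S))))
  (trans (ℚ.*-assoc ⌜ length (filter P? (elements S)) ⌝ (+ 1 ℚ./ card S) ⌜ card S ⌝)
    (trans (cong (⌜ length (filter P? (elements S)) ⌝ ℚ.*_) (1/n*n (card S))) (ℚ.*-identityʳ _)))

⌜⌝-pos : ∀ n .{{_ : ℕ.NonZero n}} → ℚ.Positive ⌜ n ⌝
⌜⌝-pos n = ℚ.normalize-pos n 1

Pr-uniform-≤ : ∀ {V} {P : Pred V 0ℓ} (S : FinSet V) .{{S≢∅ : ℕ.NonZero (card S)}} (P? : Decidable P) b →
  length (filter P? (elements S)) ℕ.* b ℕ.≤ card S → Pr (uniform S {{S≢∅}}) P? ℚ.* ⌜ b ⌝ ℚ.≤ 1ℚ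
Pr-uniform-≤ S {{S≢∅}} P? b h = ℚ.*-cancelʳ-≤-pos ⌜ card S ⌝ {{⌜⌝-pos (card S)}} (begin
  Pr (uniform S {{S≢∅}}) P? ℚ.* ⌜ b ⌝ ℚ.* ⌜ card S ⌝ ≡⟨ swap (Pr (uniform S {{S≢∅}}) P?) ⌜ b ⌝ ⌜ card S ⌝ ⟩
  Pr (uniform S {{S≢∅}}) P? ℚ.* ⌜ card S ⌝ ℚ.* ⌜ b ⌝ ≡⟨ cong (ℚ._* ⌜ b ⌝) (Pr-uniform S {{S≢∅}} P?) ⟩
  ⌜ length (filter P? (elements S)) ⌝ ℚ.* ⌜ b ⌝ ≡⟨ ⌜⌝-* (length (filter P? (elements S))) b ⟨
  ⌜ length (filter P? (elements S)) ℕ.* b ⌝   ≤⟨ ⌜⌝-mono-≤ h ⟩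
  ⌜ card S ⌝                                  ≡⟨ ℚ.*-identityˡ ⌜ card S ⌝ ⟨
  1ℚ ℚ.* ⌜ card S ⌝                           ∎)
  where
  open ℚ.≤-Reasoning
  swap : ∀ x y z → x ℚ.* y ℚ.* z ≡ x ℚ.* z ℚ.* y
  swap = solve 3 (λ x y z → x :* y :* z := x :* z :* y) refl
    where open ℚ-Solver

-- From the real hypotheses to an integer inequality

≤+⇒-≤ : ∀ {a b c} → a ℚ.≤ b ℚ.+ c → a ℚ.- c ℚ.≤ b
≤+⇒-≤ {a} {b} {c} h = subst (a ℚ.- c ℚ.≤_)
  (trans (ℚ.+-assoc b c (ℚ.- c)) (trans (cong (b ℚ.+_) (ℚ.+-inverseʳ c)) (ℚ.+-identityʳ b)))
  (ℚ.+-monoˡ-≤ (ℚ.- c) h)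

-- i ≤ y and μ ≤ ν / y hold up to ε, which is small enough that i μ ≤ ν holds
-- up to less than 1; for integers the error then disappears.
bounded-ratios⇒< : ∀ {i μ ν ε y y⁻¹} → 0ℚ ℚ.< ε → ε ℚ.≤ μ → ε ℚ.* (1ℚ ℚ.+ (i ℚ.+ (μ ℚ.+ μ))) ≡ 1ℚ →
  0ℚ ℚ.< y → y ℚ.* y⁻¹ ≡ 1ℚ → μ ℚ.≤ ν ℚ.* y⁻¹ ℚ.+ ε → i ℚ.≤ y ℚ.+ (ε ℚ.+ ε) →
  i ℚ.* μ ℚ.< 1ℚ ℚ.+ ν
bounded-ratios⇒< {i} {μ} {ν} {ε} {y} {y⁻¹} ε>0 ε≤μ ε-def y>0 y*y⁻¹≡1 hμ hi = begin-strict
  i ℚ.* μ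
    -- The product of the two weakened bounds misses i μ by ε (i + 2μ) - 2ε², which the choice ε (1
    -- + i + 2μ) = 1 keeps below 1.
    ≡⟨ expand i μ ε ⟩
  (μ ℚ.- ε) ℚ.* (i ℚ.- (ε ℚ.+ ε)) ℚ.+ (ε ℚ.* s ℚ.- ε ℚ.* (ε ℚ.+ ε))
    ≤⟨ ℚ.+-monoˡ-≤ (ε ℚ.* s ℚ.- ε ℚ.* (ε ℚ.+ ε))
         (ℚ.*-monoˡ-≤-nonNeg (μ ℚ.- ε) {{ℚ.nonNegative μ-ε≥0}} (≤+⇒-≤ hi)) ⟩
  (μ ℚ.- ε) ℚ.* y ℚ.+ (ε ℚ.* s ℚ.- ε ℚ.* (ε ℚ.+ ε))
    ≤⟨ ℚ.+-monoˡ-≤ (ε ℚ.* s ℚ.- ε ℚ.* (ε ℚ.+ ε)) [μ-ε]y≤ν ⟩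
  ν ℚ.+ (ε ℚ.* s ℚ.- ε ℚ.* (ε ℚ.+ ε))
    <⟨ ℚ.+-monoʳ-< ν small ⟩
  ν ℚ.+ 1ℚ
    ≡⟨ ℚ.+-comm ν 1ℚ ⟩
  1ℚ ℚ.+ ν ∎
  where
  open ℚ.≤-Reasoning
  s : ℚ
  s = i ℚ.+ (μ ℚ.+ μ)

  instance
    ε-nonNeg : ℚ.NonNegative ε
    ε-nonNeg = ℚ.nonNegative (ℚ.<⇒≤ ε>0)

  expand : ∀ i μ ε → i ℚ.* μ ≡ (μ ℚ.- ε) ℚ.* (i ℚ.- (ε ℚ.+ ε)) ℚ.+
                     (ε ℚ.* (i ℚ.+ (μ ℚ.+ μ)) ℚ.- ε ℚ.* (ε ℚ.+ ε))
  expand = solve 3 (λ i μ ε → i :* μ := (μ :- ε) :* (i :- (ε :+ ε)) :+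
                     (ε :* (i :+ (μ :+ μ)) :- ε :* (ε :+ ε))) refl
    where open ℚ-Solver

  μ-ε≥0 : 0ℚ ℚ.≤ μ ℚ.- ε
  μ-ε≥0 = subst (ℚ._≤ μ ℚ.- ε) (ℚ.+-inverseʳ ε) (ℚ.+-monoˡ-≤ (ℚ.- ε) ε≤μ)

  [μ-ε]y≤ν : (μ ℚ.- ε) ℚ.* y ℚ.≤ ν
  [μ-ε]y≤ν = begin
    (μ ℚ.- ε) ℚ.* y      ≤⟨ ℚ.*-monoʳ-≤-nonNeg y {{ℚ.nonNegative (ℚ.<⇒≤ y>0)}} (≤+⇒-≤ {μ} {ν ℚ.* y⁻¹} {ε} hμ) ⟩
    ν ℚ.* y⁻¹ ℚ.* y      ≡⟨ ℚ.*-assoc ν y⁻¹ y ⟩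
    ν ℚ.* (y⁻¹ ℚ.* y)    ≡⟨ cong (ν ℚ.*_) (trans (ℚ.*-comm y⁻¹ y) y*y⁻¹≡1) ⟩
    ν ℚ.* 1ℚ             ≡⟨ ℚ.*-identityʳ ν ⟩
    ν                    ∎

  small : ε ℚ.* s ℚ.- ε ℚ.* (ε ℚ.+ ε) ℚ.< 1ℚ
  small = begin-strict
    ε ℚ.* s ℚ.- ε ℚ.* (ε ℚ.+ ε)
      ≤⟨ ℚ.+-monoʳ-≤ (ε ℚ.* s) (ℚ.neg-antimono-≤ (ℚ.nonNegative⁻¹ (ε ℚ.* (ε ℚ.+ ε))
           {{ℚ.nonNeg*nonNeg⇒nonNeg ε (ε ℚ.+ ε) {{ℚ.nonNeg+nonNeg⇒nonNeg ε ε}}}})) ⟩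
    ε ℚ.* s ℚ.+ 0ℚ          <⟨ ℚ.+-monoʳ-< (ε ℚ.* s) ε>0 ⟩
    ε ℚ.* s ℚ.+ ε           ≡⟨ factor ε s ⟩
    ε ℚ.* (1ℚ ℚ.+ s)        ≡⟨ ε-def ⟩
    1ℚ                      ∎
    where
    factor : ∀ e x → e ℚ.* x ℚ.+ e ≡ e ℚ.* (1ℚ ℚ.+ x)
    factor = solve 2 (λ e x → e :* x :+ e := e :* (con 1ℚ :+ x)) refl
      where open ℚ-Solver

-- From Δ ≥ 1 and I ≤ (K - 1)Δ follows I + 1 ≤ KΔ, which multiplied with M ≤ N / (KΔ) gives the
-- claim. Both bounds are read at a single pair of indices with a fixed error ε, and the result (I +
-- 1) M < 1 + N is exact because the quantities are integers.
threshold : ∀ M I N Δ K (KΔ>0 : 0ℝ < K * Δ) → 1 ℕ.≤ M → 1ℝ ≤ Δ →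
  fromℕ M ≤ fromℕ N ÷ (K * Δ) [ KΔ>0 ] → fromℕ I ≤ (K - 1ℝ) * Δ → suc I ℕ.* M ℕ.≤ N
threshold M I N Δ K (δ , δ>0 , M₀ , δ≤) 1≤M 1≤Δ hM hI =
  ℕ.s≤s⁻¹ (⌜⌝-cancel-< (subst₂ ℚ._<_ (sym (⌜⌝-* (suc I) M)) (sym (⌜⌝-+ 1 N))
    (bounded-ratios⇒< {⌜ suc I ⌝} {⌜ M ⌝} {⌜ N ⌝} {ε} {y} {(ℚ.1/ y) {{ℚ.>-nonZero y>0}}}
      ε>0 (ℚ.≤-trans ε≤1 (⌜⌝-mono-≤ 1≤M)) ε*[1+t]≡1 y>0
      (ℚ.*-inverseʳ y {{ℚ.>-nonZero y>0}}) (proj₂ (hM ε ε>0) n n≥M₁) 1+I≤)))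
  where
  open ℚ.≤-Reasoning
  t : ℕ
  t = suc I ℕ.+ 2 ℕ.* M

  -- The reciprocal of 1 + i + 2μ for i = I + 1 and μ = M, as `bounded-ratios⇒<` demands.
  ε : ℚ
  ε = + 1 ℚ./ suc t

  ε>0 : 0ℚ ℚ.< ε
  ε>0 = ℚ.positive⁻¹ ε {{ℚ.normalize-pos 1 (suc t)}}

  ε*[1+t]≡1 : ε ℚ.* (1ℚ ℚ.+ (⌜ suc I ⌝ ℚ.+ (⌜ M ⌝ ℚ.+ ⌜ M ⌝))) ≡ 1ℚ
  ε*[1+t]≡1 = trans (cong (ε ℚ.*_) (sym (trans (⌜⌝-+ 1 t) (cong (1ℚ ℚ.+_)
    (trans (⌜⌝-+ (suc I) (2 ℕ.* M)) (cong (⌜ suc I ⌝ ℚ.+_)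
      (trans (cong (λ k → ⌜ M ℕ.+ k ⌝) (ℕ.+-identityʳ M)) (⌜⌝-+ M M)))))))) (/-* 1 t)

  ε≤1 : ε ℚ.≤ 1ℚ
  ε≤1 = begin
    ε                 ≡⟨ ℚ.*-identityʳ ε ⟨
    ε ℚ.* ⌜ 1 ⌝       ≤⟨ ℚ.*-monoˡ-≤-nonNeg ε {{ℚ.nonNegative (ℚ.<⇒≤ ε>0)}} (⌜⌝-mono-≤ {1} {suc t} (s≤s z≤n)) ⟩
    ε ℚ.* ⌜ suc t ⌝   ≡⟨ /-* 1 t ⟩
    1ℚ                ∎

  M₁ M₂ M₃ n j : ℕ
  M₁ = proj₁ (hM ε ε>0)
  M₂ = proj₁ (1≤Δ ε ε>0)
  M₃ = proj₁ (hI ε ε>0)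
  n  = M₁ ℕ.+ (M₂ ℕ.+ M₃)
  -- `reciprocal` shifts its sequence by M₀, so term n of the quotient inverts term j of `K * Δ`;
  -- the bounds on Δ and I are therefore read at j and the one on M at n.
  j  = M₀ ℕ.+ n

  y : ℚ
  y = seq K j ℚ.* seq Δ j

  y>0 : 0ℚ ℚ.< y
  y>0 = ℚ.<-≤-trans δ>0 (subst (ℚ._≤ y) (ℚ.+-identityˡ δ) (δ≤ j (ℕ.m≤m+n M₀ n)))

  n≥M₁ : M₁ ℕ.≤ n
  n≥M₁ = ℕ.m≤m+n M₁ (M₂ ℕ.+ M₃)

  j≥M₂+M₃ : M₂ ℕ.+ M₃ ℕ.≤ j
  j≥M₂+M₃ = ℕ.≤-trans (ℕ.m≤n+m (M₂ ℕ.+ M₃) M₁) (ℕ.m≤n+m n M₀)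

  regroup : ∀ d k e → (d ℚ.+ e) ℚ.+ ((k ℚ.- 1ℚ) ℚ.* d ℚ.+ e) ≡ k ℚ.* d ℚ.+ (e ℚ.+ e)
  regroup = solve 3 (λ d k e → (d :+ e) :+ ((k :- con 1ℚ) :* d :+ e) := k :* d :+ (e :+ e)) refl
    where open ℚ-Solver

  1+I≤ : ⌜ suc I ⌝ ℚ.≤ y ℚ.+ (ε ℚ.+ ε)
  1+I≤ = begin
    ⌜ suc I ⌝
      ≡⟨ ⌜⌝-+ 1 I ⟩
    1ℚ ℚ.+ ⌜ I ⌝
      -- The 1 is bounded by Δ, which completes (K - 1)Δ to KΔ at the cost of a second ε.
      ≤⟨ ℚ.+-mono-≤ (proj₂ (1≤Δ ε ε>0) j (ℕ.m+n≤o⇒m≤o M₂ j≥M₂+M₃))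
                    (proj₂ (hI ε ε>0) j (ℕ.m+n≤o⇒n≤o M₂ j≥M₂+M₃)) ⟩
    (seq Δ j ℚ.+ ε) ℚ.+ ((seq K j ℚ.- 1ℚ) ℚ.* seq Δ j ℚ.+ ε)
      ≡⟨ regroup (seq Δ j) (seq K j) ε ⟩
    y ℚ.+ (ε ℚ.+ ε) ∎

-- Deficiency and min-entropy rate

private
  rate-exponent : ∀ i j M p → i ℚ.* M ≡ 1ℚ → M ≡ 1ℚ ℚ.+ p →
                  (ℚ.- ((1ℚ ℚ.- i) ℚ.* j)) ℚ.* M ≡ ℚ.- (p ℚ.* j)
  rate-exponent i j M p eq eq′ = trans (regroup i j M) (trans (cong₂ (λ u v → ℚ.- ((u ℚ.- v) ℚ.* j)) eq′ eq)
    (cancel p j))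
    where
    open ℚ-Solver
    regroup : ∀ i j M → (ℚ.- ((1ℚ ℚ.- i) ℚ.* j)) ℚ.* M ≡ ℚ.- ((M ℚ.- i ℚ.* M) ℚ.* j)
    regroup = solve 3 (λ i j M → (:- ((con 1ℚ :- i) :* j)) :* M := :- ((M :- i :* M) :* j)) refl
    cancel : ∀ p j → ℚ.- (((1ℚ ℚ.+ p) ℚ.- 1ℚ) ℚ.* j) ≡ ℚ.- (p ℚ.* j)
    cancel = solve 2 (λ p j → :- (((con 1ℚ :+ p) :- con 1ℚ) :* j) := :- (p :* j)) refl

deficiency≤ : ∀ {m N} (D : Distribution (Vec (Vec Bool m) N)) {i c e} →
  seq (log₂ℕ ((2 ℕ.^ m) ℕ.^ N)) i ℚ.≤ c ℚ.+ e → seq (entropy D) i ≡ c →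
  seq (entropyDeficiency D) i ℚ.≤ e
deficiency≤ D {c = c} {e} h refl = ≤+⇒-≤ (ℚ.≤-trans h (ℚ.≤-reflexive (ℚ.+-comm c e)))

-- The logarithm of 2 ∣S∣ is the entropy of S plus 1 at every index, so the bound holds termwise.
half⇒deficiency≤1 : ∀ {m N} (S : FinSet (Vec (Vec Bool m) N)) .{{S≢∅ : ℕ.NonZero (card S)}} →
  (2 ℕ.^ m) ℕ.^ N ℕ.≤ 2 ℕ.* card S → ∀ i → seq (entropyDeficiency (uniform S {{S≢∅}})) i ℚ.≤ ⌜ 1 ⌝
half⇒deficiency≤1 {m} {N} S {{S≢∅}} half i = deficiency≤ (uniform S {{S≢∅}}) {i} {seq (log₂ℕ (card S)) i} {⌜ 1 ⌝}
  (ℚ.≤-trans log-half (ℚ.≤-reflexive (log₂ℕ-shift (card S) 1 i))) (seq-entropy-uniform S {{S≢∅}} i)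
  where
  log-half : seq (log₂ℕ ((2 ℕ.^ m) ℕ.^ N)) i ℚ.≤ seq (log₂ℕ (card S ℕ.* 2 ℕ.^ 1)) i
  log-half = log₂ℕ-mono {(2 ℕ.^ m) ℕ.^ N} {card S ℕ.* 2 ℕ.^ 1} {{ℕ.m^n≢0 (2 ℕ.^ m) N {{ℕ.m^n≢0 2 m}}}}
    (ℕ.≤-trans half (ℕ.≤-reflexive (ℕ.*-comm 2 (card S)))) i

≤1∧1≤⇒≤ : ∀ {x y} → (∀ k → seq x k ℚ.≤ ⌜ 1 ⌝) → 1ℝ ≤ y → x ≤ y
≤1∧1≤⇒≤ x≤1 1≤y ε ε>0 = let n₀ , 1≤ = 1≤y ε ε>0 in n₀ , λ n n≥n₀ → ℚ.≤-trans (x≤1 n) (1≤ n n≥n₀)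

≤-refl : ∀ x → x ≤ x
≤-refl x = pointwise⇒≤ x x λ _ → ℚ.≤-refl

-- With m = m′ + 1, (1 - 1/m) m = m′: the real power of 2^m in the definition of the rate is the
-- integer power 2^(-m′ j), and the approximants are constant.
seq-exponent : ∀ m′ j i →
  seq (- ((1ℝ - fromℚ (+ 1 ℚ./ suc m′)) * fromℕ j) * log₂ℕ (2 ℕ.^ suc m′)) i ≡ ℚ.- ⌜ m′ ℕ.* j ⌝
seq-exponent m′ j i = trans
  (cong ((ℚ.- ((1ℚ ℚ.- (+ 1 ℚ./ suc m′)) ℚ.* ⌜ j ⌝)) ℚ.*_) (log₂ℕ-2^ (suc m′) i))
  (trans (rate-exponent (+ 1 ℚ./ suc m′) ⌜ j ⌝ ⌜ suc m′ ⌝ ⌜ m′ ⌝ (/-* 1 m′) (⌜⌝-+ 1 m′))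
    (cong ℚ.-_ (sym (⌜⌝-* m′ j))))

small-fibres⇒admissible : ∀ {m′ N} (S : FinSet (Vec (Vec Bool (suc m′)) N)) .{{S≢∅ : ℕ.NonZero (card S)}} →
  (∀ J α → length (filter (λ y → restrict J y ≟ᵛ α) (elements S)) ℕ.* 2 ℕ.^ (m′ ℕ.* ∣ J ∣) ℕ.≤ card S) →
  AdmissibleRate (uniform S {{S≢∅}}) (1ℝ - fromℚ (+ 1 ℚ./ suc m′))
small-fibres⇒admissible {m′} S {{S≢∅}} h J α Pr>0 = pointwise⇒≤
  (log₂ (Pr (uniform S {{S≢∅}}) P?)) (- ((1ℝ - fromℚ (+ 1 ℚ./ suc m′)) * fromℕ ∣ J ∣) * log₂ℕ (2 ℕ.^ suc m′)) λ i →
  ℚ.≤-trans (log₂-≤ (Pr (uniform S {{S≢∅}}) P?) (m′ ℕ.* ∣ J ∣) Pr>0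
              (Pr-uniform-≤ S {{S≢∅}} P? (2 ℕ.^ (m′ ℕ.* ∣ J ∣)) (h J α)) i)
            (ℚ.≤-reflexive (sym (seq-exponent m′ ∣ J ∣ i)))
  where
  P? : Decidable (λ y → restrict J y ≡ α)
  P? y = restrict J y ≟ᵛ α

dense-and-spread : ∀ {m′ N} (Δ : ℝ) → 1ℝ ≤ Δ →
  (S : FinSet (Vec (Vec Bool (suc m′)) N)) (S≢∅ : ℕ.NonZero (card S)) →
  (2 ℕ.^ suc m′) ℕ.^ N ℕ.≤ 2 ℕ.* card S →
  (∀ J α → length (filter (λ y → restrict J y ≟ᵛ α) (elements S)) ℕ.* 2 ℕ.^ (m′ ℕ.* ∣ J ∣) ℕ.≤ card S) →
  entropyDeficiency (uniform S {{S≢∅}}) ≤ Δ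
  × MinEntropyRate≥ (uniform S {{S≢∅}}) (1ℝ - fromℚ (+ 1 ℚ./ suc m′))
dense-and-spread {m′} Δ 1≤Δ S S≢∅ half fibres =
  ≤1∧1≤⇒≤ {entropyDeficiency (uniform S {{S≢∅}})} {Δ} (half⇒deficiency≤1 S {{S≢∅}} half) 1≤Δ
  , (1ℝ - fromℚ (+ 1 ℚ./ suc m′) , small-fibres⇒admissible S {{S≢∅}} fibres
    , ≤-refl (1ℝ - fromℚ (+ 1 ℚ./ suc m′)))

-- The set of vectors with many all-ones blocks

module Construction (N m′ : ℕ) where

  private
    m M k : ℕ
    m = suc m′
    M = 2 ℕ.^ m
    instance
      M≢0 : ℕ.NonZero M
      M≢0 = ℕ.m^n≢0 2 m
    -- The largest k with k M ≤ N: the inequality is what the median estimate asks for, and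
    -- maximality is what excludes the zero string.
    k = N ℕ./ M

    ones : Vec Bool m
    ones = replicate m true

  Y : FinSet (Vec (Vec Bool m) N)
  Y = record
    { elements = frequent _≟ʷ_ ones (words m) N k
    ; unique   = Unique.filter⁺ (λ y → k ℕ.≤? full y) (vectors-unique (words-unique m) N)
    }

  Y-majority : M ℕ.^ N ℕ.≤ 2 ℕ.* card Y
  Y-majority = majority (words-ones m) (words-unique m) (length-vectors (true ∷ false ∷ []) m)
    (ℕ.^-monoʳ-< 2 (s≤s (s≤s z≤n)) {0} {m} (s≤s z≤n)) (ℕ.m/n*n≤m N M)
    where
    -- The alphabet and its size are generalised so that both equations can be matched with `refl`.
    majority : ∀ {us L} → (∃ λ vs → us ≡ ones ∷ vs) → Unique us → length us ≡ L → 1 ℕ.< L → k ℕ.* L ℕ.≤ N →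
               L ℕ.^ N ℕ.≤ 2 ℕ.* length (frequent _≟ʷ_ ones us N k)
    majority (vs , refl) (1∉vs ∷ _) refl = frequent-majority _≟ʷ_ ones 1∉vs {N} {k}

  instance
    Y≢∅ : ℕ.NonZero (card Y)
    Y≢∅ = ℕ.≢-nonZero λ eq → ℕ.<⇒≱ (ℕ.m^n>0 M N)
      (subst (λ c → M ℕ.^ N ℕ.≤ 2 ℕ.* c) eq Y-majority)

  fibre-bound : ∀ (J : Subset N) α →
    length (filter (λ y → restrict J y ≟ᵛ α) (elements Y)) ℕ.* 2 ℕ.^ (m′ ℕ.* ∣ J ∣) ℕ.≤ card Y
  fibre-bound J α = bound ∣ J ∣ (ℕ.≤-trans
    (ℕ.*-monoˡ-≤ (M ℕ.^ ∣ J ∣) (length-filter-filter P? (λ y → k ℕ.≤? full y) (vectors (words m) N)))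
    (subst (λ l → length (filter P? (vectors (words m) N)) ℕ.* l ℕ.^ ∣ J ∣ ℕ.≤ l ℕ.^ N)
      (length-vectors (true ∷ false ∷ []) m) (fibre-size _≟ʷ_ (words-unique m) J α)))
    where
    P? : Decidable (λ y → restrict J y ≡ α)
    P? y = restrict J y ≟ᵛ α
    c : ℕ
    c = length (filter P? (elements Y))

    bound : ∀ j → c ℕ.* M ℕ.^ j ℕ.≤ M ℕ.^ N → c ℕ.* 2 ℕ.^ (m′ ℕ.* j) ℕ.≤ card Y
    -- For empty `J` there is no factor 2 to spare, but the fibre is a sublist of `Y`.
    bound zero    _ = ℕ.≤-trans
      (ℕ.≤-reflexive (trans (cong (λ e → c ℕ.* 2 ℕ.^ e) (ℕ.*-zeroʳ m′)) (ℕ.*-identityʳ c)))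
      (List.length-filter P? (elements Y))
    bound (suc j) h = ℕ.*-cancelˡ-≤ 2 (begin
      2 ℕ.* (c ℕ.* x)               ≡⟨ swap 2 c x ⟩
      -- The rate 1 - 1/m gives away one bit per fixed block; with at least one block fixed, this
      -- pays for the density 1/2 of `Y`.
      c ℕ.* (2 ℕ.* x)               ≤⟨ ℕ.*-monoʳ-≤ c (ℕ.*-monoˡ-≤ x (ℕ.^-monoʳ-≤ 2 {1} {suc j} (s≤s z≤n))) ⟩
      c ℕ.* (2 ℕ.^ suc j ℕ.* x)     ≡⟨ cong (c ℕ.*_) (trans (ℕ.^-*-assoc 2 m (suc j)) (ℕ.^-distribˡ-+-* 2 (suc j) (m′ ℕ.* suc j))) ⟨
      c ℕ.* M ℕ.^ suc j             ≤⟨ h ⟩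
      M ℕ.^ N                       ≤⟨ Y-majority ⟩
      2 ℕ.* card Y                  ∎)
      where
      open ℕ.≤-Reasoning
      x : ℕ
      x = 2 ℕ.^ (m′ ℕ.* suc j)
      swap : ∀ x y z → x ℕ.* (y ℕ.* z) ≡ y ℕ.* (x ℕ.* z)
      swap = solve 3 (λ x y z → x :* (y :* z) := y :* (x :* z)) refl
        where open ℕ-Solver

  -- Dividing the hypothesis by `M` gives ∣I∣ + 1 ≤ k, whereas a y in `Y` producing the zero string
  -- would have at least k and at most ∣I∣ all-ones blocks.
  zero-string∉ : ∀ (I : Subset N) → suc ∣ I ∣ ℕ.* M ℕ.≤ N → replicate ∣ ∁ I ∣ false ∉ INDᴶ (∁ I) U ⟦ Y ⟧
  zero-string∉ I h (x , y , _ , y∈Y , eq) = ℕ.<⇒≱ (s≤s (zero-outside⇒full≤ I x y eq))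
    (ℕ.≤-trans (subst (ℕ._≤ k) (ℕ.m*n/n≡m (suc ∣ I ∣) M) (ℕ./-monoˡ-≤ M h))
      (proj₂ (∈-filter⁻ (λ y → k ℕ.≤? full y) {xs = vectors (words m) N} y∈Y)))

theorem2 : (N m : ℕ) .{{_ : ℕ.NonZero N}} .{{_ : ℕ.NonZero m}} (Δ K : ℝ)
    (1≤Δ : 1ℝ ≤ Δ) (1≤K : 1ℝ ≤ K) →
    fromℕ (2 ℕ.^ m) ≤ fromℕ N ÷ (K * Δ) [ *-pos-≥1 K Δ 1≤K 1≤Δ ] →
    Σ (FinSet (Vec (Vec Bool m) N)) λ Y → Σ (ℕ.NonZero (card Y)) λ Y≢∅ →
    entropyDeficiency (uniform Y {{Y≢∅}}) ≤ Δ
    × MinEntropyRate≥ (uniform Y {{Y≢∅}}) (1ℝ - fromℚ (+ 1 ℚ./ m))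
    × ((I : Subset N) → fromℕ ∣ I ∣ ≤ (K - 1ℝ) * Δ →
    replicate ∣ ∁ I ∣ false ∉ INDᴶ (∁ I) U ⟦ Y ⟧)
theorem2 N (suc m′) Δ K 1≤Δ 1≤K h =
  let deficiency , rate = dense-and-spread Δ 1≤Δ Y Y≢∅ Y-majority fibre-bound
  in Y , Y≢∅ , deficiency , rate , λ I hI → zero-string∉ I
      (threshold (2 ℕ.^ suc m′) ∣ I ∣ N Δ K (*-pos-≥1 K Δ 1≤K 1≤Δ) (ℕ.m^n>0 2 (suc m′)) 1≤Δ h hI)
  where open Construction N m′
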